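{- $\mathfrak{F}'\subseteq\mathcal{P}$, i.e. every connected graph with the extended distinguished edge property has property GNRP.
   Context: Graphs are finite, simple and undirected. $\mathbb{T}=\{z\in\mathbb{C}:|z|=1\}$, $\mathbb{I}=[0,2\pi)$. A $\mathbb{T}$-gain on $G$ is a map $\varphi$ from oriented edges to $\mathbb{T}$ with $\varphi(\overrightarrow{e_{ts}})=\varphi(\overrightarrow{e_{st}})^{ -1}$; $A(\Phi)$ for $\Phi=(G,\varphi)$ is the Hermitian matrix with $(s,t)$ entry $\varphi(\overrightarrow{e_{st}})$ if $v_s\sim v_t$, else $0$; $\mathcal{T}_G$ is the set of all $\mathbb{T}$-gain graphs on $G$. $\Re(A)\ge0$ means the real part of every entry of $A$ is nonnegative. The gain of a directed cycle is the product of gains of its oriented edges. A rooted spanning tree $T$ with root $v_r$ induces the tree order ($v_x\le v_y$ iff $v_x$ is on the $T$-path from $v_r$ to $v_y$); $T$ is normal if adjacent vertices of $G$ are always comparable. The suitably oriented graph $\overrightarrow{G_T}$ orients each edge $e_{st}$ with $v_s\le v_t$ as $\overrightarrow{e_{st}}$ if $e_{st}\in E(T)$ and as $\overrightarrow{e_{ts}}$ otherwise; the $m-n+1$ fundamental cycles $C_j$ of $T$ become directed cycles $\overrightarrow{C_j(T)}$. For $r=(c_1,\dots,c_{m-n+1})\in\mathbb{I}^{m-n+1}$, $\mathcal{A}_T(r)=\{(G,\varphi)\in\mathcal{T}_G:\varphi(\overrightarrow{C_j(T)})=e^{ic_j}\ \forall j\}$. $G$ has GNRP (w.r.t. normal spanning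 tree $T$) if for each $r$ there is $\Phi\in\mathcal{A}_T(r)$ with $\Re(A(\Phi))\ge0$; $\mathcal{P}$ is the class of connected graphs with GNRP. The sum of subgraphs is the subgraph consisting of all edges in at least one of them. A fundamental subgraph of $G$ w.r.t. $T$ is the sum of a maximal collection of fundamental cycles whose sum intersects $T$ in a subtree. $K_4'$ denotes either $K_4$ or a subdivision of $K_4$ (a graph obtained from $K_4$ by repeatedly replacing an edge by a path of length two through a new vertex). A fundamental subgraph $\mathfrak{B}$ whose set $S$ of fundamental cycles contains three cycles $C_1',C_2',C_3'$ with $C_1'+C_2'+C_3'$ equal to a $K_4'$ is called $K_4'$-initiated; it equals $K_4'+C_1+\cdots+C_s$ where $C_1,\dots,C_s$ are the other cycles of $S$, and it has DEP if the $C_i$ can be ordered $C_{k_1},\dots,C_{k_s}$ so that $|E(C_{k_i})\setminus E(C_{k_0}+C_{k_1}+\cdots+C_{k_{i-1}})|>1$ for $i=1,\dots,s$, where $C_{k_0}=K_4'$. A non-$K_4'$-initiated fundamental subgraph built from cycles $C_1,\dots,C_s$ has DEP if they can be ordered $C_{k_1},\dots,C_{k_s}$ with $|E(C_{k_i})\setminus E(C_{k_1}+\cdots+C_{k_{i-1}})|>1$ for $i=2,\dots,s$. A connected graph has the extended distinguished edge property (EDEP) if all its $K_4'$-initiated and non-$K_4'$-initiated fundamental subgraphs with respect to a normal spanning tree $T$ have DEP (in the respective sense). $\mathfrak{F}'$ is the collection of connected graphs with EDEP. -}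

module Defs where

open import Algebra.Structures using (IsCommutativeRing)
open import Data.Empty using (⊥)
open import Data.Fin using (Fin)
open import Data.List using (List; []; _∷_; length)
open import Data.List.Membership.Propositional using () renaming (_∈_ to _∈ₗ_)
open import Data.List.Relation.Unary.Unique.Propositional using (Unique)
open import Data.Nat using (ℕ) renaming (_≤_ to _≤ℕ_)
open import Data.Product using (Σ; ∃; ∃-syntax; _×_; _,_; proj₁; proj₂)
open import Data.Sum using (_⊎_)
open import Data.Unit using (⊤)
open import Function.Bundles using (_⇔_)
open import Function.Definitions using (Injective)
open import Level using (0ℓ; suc)
open import Relation.Binary using (Rel; Decidable; Symmetric; Irreflexive; IsTotalOrder)
open import Relation.Binary.Construct.Closure.ReflexiveTransitive using (Star; ε; _◅_)
open import Relation.Binary.PropositionalEquality using (_≡_; _≢_)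
open import Relation.Nullary using (¬_; yes; no)
open import Relation.Unary using (Pred; _⊆_) renaming (_∈_ to _∈ₚ_)

------------------------------------------------------------------------
-- Real and complex numbers

-- The real numbers, given by axioms that determine them up to unique
-- isomorphism: a Dedekind-complete ordered field together with π, cos and
-- sin.  The last group of fields is Apostol's axiomatisation of the
-- circular functions (Calculus I, §2.5); its last two inequalities are
-- cos x < sin x / x < 1 / cos x without the divisions.
record RealNumbers : Set₁ where
  infixl 7 _*_
  infixl 6 _+_
  infix  8 -_
  infix  4 _≤_ _<_
  field
    ℝ       : Set
    _+_ _*_ : ℝ → ℝ → ℝ
    -_      : ℝ → ℝ
    0# 1#   : ℝ
    _≤_     : Rel ℝ 0ℓ

    isCommutativeRing : IsCommutativeRing _≡_ _+_ _*_ -_ 0# 1#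
    0≢1               : 0# ≢ 1#
    inverse           : ∀ {x} → x ≢ 0# → ∃[ y ] x * y ≡ 1#

    isTotalOrder : IsTotalOrder _≡_ _≤_
    +-monoˡ-≤    : ∀ {x y} z → x ≤ y → x + z ≤ y + z
    *-nonNeg     : ∀ {x y} → 0# ≤ x → 0# ≤ y → 0# ≤ x * y

  _<_ : Rel ℝ 0ℓ
  x < y = x ≤ y × x ≢ y

  IsUpperBound : Pred ℝ 0ℓ → ℝ → Set
  IsUpperBound P b = ∀ {x} → P x → x ≤ b

  field
    supremum : (P : Pred ℝ 0ℓ) → ∃ P → ∃ (IsUpperBound P) →
               ∃[ s ] IsUpperBound P s × (∀ {b} → IsUpperBound P b → s ≤ b)

    cos sin   : ℝ → ℝ
    π/2       : ℝ
    0<π/2     : 0# < π/2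
    cos-0     : cos 0# ≡ 1#
    sin-π/2   : sin π/2 ≡ 1#
    cos-π     : cos (π/2 + π/2) ≡ - 1#
    cos-minus : ∀ x y → cos (y + - x) ≡ cos y * cos x + sin y * sin x
    0<cos     : ∀ {x} → 0# < x → x < π/2 → 0# < cos x
    xcos<sin  : ∀ {x} → 0# < x → x < π/2 → x * cos x < sin x
    sincos<x  : ∀ {x} → 0# < x → x < π/2 → sin x * cos x < x

  2π : ℝ
  2π = (π/2 + π/2) + (π/2 + π/2)

  -- 𝕀 = [0,2π)
  𝕀 : Pred ℝ 0ℓ
  𝕀 c = 0# ≤ c × c < 2π

  ℂ : Set
  ℂ = ℝ × ℝ

  Re : ℂ → ℝ
  Re = proj₁

  0ᶜ 1ᶜ : ℂ
  0ᶜ = 0# , 0#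
  1ᶜ = 1# , 0#

  infixl 7 _*ᶜ_
  _*ᶜ_ : ℂ → ℂ → ℂ
  (a , b) *ᶜ (c , d) = (a * c + - (b * d)) , (a * d + b * c)

  -- The unit circle; |z| = 1 is written as |z|² = 1.
  𝕋 : Pred ℂ 0ℓ
  𝕋 (a , b) = a * a + b * b ≡ 1#

  e^i_ : ℝ → ℂ
  e^i c = cos c , sin c

------------------------------------------------------------------------
-- Edge sets on a vertex type V.  An edge set is a symmetric relation, and
-- an unordered edge {a,b} is presented by either of its two orientations.

module _ {V : Set} where

  SameEdge : V → V → V → V → Set
  SameEdge a b c d = (a ≡ c × b ≡ d) ⊎ (a ≡ d × b ≡ c)

  infixr 6 _⊕_
  _⊕_ : Rel V 0ℓ → Rel V 0ℓ → Rel V 0ℓ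
  (X ⊕ Y) a b = X a b ⊎ Y a b

  infixr 7 _∩ᴱ_
  _∩ᴱ_ : Rel V 0ℓ → Rel V 0ℓ → Rel V 0ℓ
  (X ∩ᴱ Y) a b = X a b × Y a b

  infixl 6 _∖_
  _∖_ : Rel V 0ℓ → Rel V 0ℓ → Rel V 0ℓ
  (X ∖ Y) a b = X a b × ¬ Y a b

  -- The number of (unordered) edges in X exceeds one.
  MoreThanOneEdge : Rel V 0ℓ → Set
  MoreThanOneEdge X =
    ∃[ a ] ∃[ b ] ∃[ c ] ∃[ d ] X a b × X c d × ¬ SameEdge a b c d

  Covers : Rel V 0ℓ → Pred V 0ℓ
  Covers X u = ∃[ v ] X u v

  vertices : ∀ {R : Rel V 0ℓ} {u v} → Star R u v → List V
  vertices {u = u} ε       = u ∷ []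
  vertices {u = u} (_ ◅ p) = u ∷ vertices p

  walkEdges : ∀ {R : Rel V 0ℓ} {u v} → Star R u v → Rel V 0ℓ
  walkEdges ε                   a b = ⊥
  walkEdges (_◅_ {i} {j} _ p) a b = SameEdge a b i j ⊎ walkEdges p a b

  Path : Rel V 0ℓ → V → V → Set
  Path R u v = Σ (Star R u v) λ p → Unique (vertices p)

  -- A cycle is a path on at least three vertices whose ends are adjacent.
  Acyclic : Rel V 0ℓ → Set
  Acyclic R = ∀ {u v} ((p , _) : Path R u v) → 3 ≤ℕ length (vertices p) → ¬ R v u

  -- For the subgraph with edge set X and without isolated vertices.
  IsSubtree : Rel V 0ℓ → Set
  IsSubtree X =
    (∀ {u v} → Covers X u → Covers X v → Path X u v) × Acyclic X

  -- Edge sets that form a K₄ or an iterated subdivision of a K₄ on some of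
  -- the vertices.  Subdividing uses a vertex w of V not yet covered; the
  -- intermediate graphs may have edges that are absent from the ambient
  -- graph in which the final edge set lives.
  data K₄′ : Rel V 0ℓ → Set₁ where
    complete  : ∀ {X} (f : Fin 4 → V) → Injective _≡_ _≡_ f →
                (∀ a b → X a b ⇔ (∃[ i ] ∃[ j ] i ≢ j × a ≡ f i × b ≡ f j)) →
                K₄′ X
    subdivide : ∀ {X Y u v w} → K₄′ X → X u v → ¬ Covers X w →
                (∀ a b → Y a b ⇔
                  ((X a b × ¬ SameEdge a b u v) ⊎ SameEdge a b u w ⊎ SameEdge a b w v)) →
                K₄′ Y

------------------------------------------------------------------------
-- Graphs and normal spanning trees

record Graph : Set₁ where
  infix 4 _~_ _~?_
  field
    order : ℕ
  V : Set
  V = Fin order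
  field
    _~_    : Rel V 0ℓ
    _~?_   : Decidable _~_
    sym    : Symmetric _~_
    irrefl : Irreflexive _≡_ _~_

Connected : Graph → Set
Connected G = ∀ u v → Path _~_ u v
  where open Graph G

module _ (G : Graph) where
  open Graph G

  record NormalSpanningTree : Set₁ where
    infix 4 _~ᵀ_ _≤ᵀ_
    field
      root    : V
      _~ᵀ_    : Rel V 0ℓ
      subset  : ∀ {u v} → u ~ᵀ v → u ~ v
      symᵀ    : Symmetric _~ᵀ_
      path    : ∀ u v → Path _~ᵀ_ u v
      acyclic : Acyclic _~ᵀ_

    -- The walk underlying the (unique) T-path from u to v.
    treeWalk : ∀ u v → Star _~ᵀ_ u v
    treeWalk u v = proj₁ (path u v)

    _≤ᵀ_ : Rel V 0ℓ
    x ≤ᵀ y = x ∈ₗ vertices (treeWalk root y)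

    field
      normal : ∀ {s t} → s ~ t → s ≤ᵀ t ⊎ t ≤ᵀ s

module _ {G : Graph} (T : NormalSpanningTree G) where
  open Graph G
  open NormalSpanningTree T

  -- The edges of G outside T.  They index the m - n + 1 fundamental cycles.
  -- The endpoints are ordered by the tree order, and the conditions are
  -- irrelevant, so every such edge is represented by exactly one chord.
  record Chord : Set where
    constructor chord
    field
      lo hi    : V
      .edge    : lo ~ hi
      .nonTree : ¬ (lo ~ᵀ hi)
      .lo≤hi   : lo ≤ᵀ hi

  -- Edge set of the fundamental cycle of a chord.
  cycle : Chord → Rel V 0ℓ
  cycle c = walkEdges (treeWalk lo hi) ⊕ λ a b → SameEdge a b lo hi
    where open Chord c

  sum : Pred Chord 0ℓ → Rel V 0ℓ
  sum S a b = ∃[ c ] S c × cycle c a b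

  -- Every vertex of a fundamental cycle lies on a tree edge of that cycle,
  -- so the intersection with T has no isolated vertices.
  MeetsInSubtree : Pred Chord 0ℓ → Set
  MeetsInSubtree S = IsSubtree (sum S ∩ᴱ _~ᵀ_)

  -- S is the collection of fundamental cycles of a fundamental subgraph.
  IsFundamental : Pred Chord 0ℓ → Set₁
  IsFundamental S =
    MeetsInSubtree S × (∀ S′ → S ⊆ S′ → MeetsInSubtree S′ → S′ ⊆ S)

  Enumerates : List Chord → Pred Chord 0ℓ → Set
  Enumerates cs S = Unique cs × (∀ c → c ∈ₗ cs ⇔ S c)

  -- Each cycle of the list has more than one edge outside the sum of B and
  -- the cycles preceding it.
  Distinguished : Rel V 0ℓ → List Chord → Set
  Distinguished B []       = ⊤
  Distinguished B (c ∷ cs) =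
    MoreThanOneEdge (cycle c ∖ B) × Distinguished (B ⊕ cycle c) cs

  DistinguishedFromFirst : List Chord → Set
  DistinguishedFromFirst []       = ⊤
  DistinguishedFromFirst (c ∷ cs) = Distinguished (cycle c) cs

  sum₃ : Chord → Chord → Chord → Rel V 0ℓ
  sum₃ c₁ c₂ c₃ = cycle c₁ ⊕ cycle c₂ ⊕ cycle c₃

  record K₄′-Triple (S : Pred Chord 0ℓ) (c₁ c₂ c₃ : Chord) : Set₁ where
    field
      c₁∈S     : S c₁
      c₂∈S     : S c₂
      c₃∈S     : S c₃
      c₁≢c₂    : c₁ ≢ c₂
      c₁≢c₃    : c₁ ≢ c₃
      c₂≢c₃    : c₂ ≢ c₃
      sum-K₄′  : K₄′ (sum₃ c₁ c₂ c₃)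

  K₄′-Initiated : Pred Chord 0ℓ → Set₁
  K₄′-Initiated S = ∃[ c₁ ] ∃[ c₂ ] ∃[ c₃ ] K₄′-Triple S c₁ c₂ c₃

  -- DEP for K₄′-initiated fundamental subgraphs, for some choice of the K₄′.
  DEP-K₄′ : Pred Chord 0ℓ → Set₁
  DEP-K₄′ S = ∃[ c₁ ] ∃[ c₂ ] ∃[ c₃ ] K₄′-Triple S c₁ c₂ c₃ ×
    ∃[ cs ] Enumerates cs (λ c → S c × c ≢ c₁ × c ≢ c₂ × c ≢ c₃)
          × Distinguished (sum₃ c₁ c₂ c₃) cs

  -- DEP for the other fundamental subgraphs.
  DEP : Pred Chord 0ℓ → Set
  DEP S = ∃[ cs ] Enumerates cs S × DistinguishedFromFirst cs

  EDEP : Set₁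
  EDEP = ∀ S → IsFundamental S →
    (K₄′-Initiated S → DEP-K₄′ S) × (¬ K₄′-Initiated S → DEP S)

𝔉′ : Pred Graph (suc 0ℓ)
𝔉′ G = Connected G × ∃[ T ] EDEP {G} T

------------------------------------------------------------------------
-- 𝕋-gain graphs

module _ (ℛ : RealNumbers) where
  open RealNumbers ℛ

  -- φ s t is the gain of the edge oriented from s to t; its values at
  -- non-adjacent pairs are never used.
  record GainGraph (G : Graph) : Set where
    open Graph G
    field
      φ     : V → V → ℂ
      φ∈𝕋   : ∀ {s t} → s ~ t → φ s t ∈ₚ 𝕋
      φ-inv : ∀ {s t} → s ~ t → φ t s *ᶜ φ s t ≡ 1ᶜ

  module _ {G : Graph} where
    open Graph G

    adjacency : GainGraph G → V → V → ℂ
    adjacency Φ s t with s ~? t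
    ... | yes _ = GainGraph.φ Φ s t
    ... | no  _ = 0ᶜ

    walkGain : GainGraph G → ∀ {R : Rel V 0ℓ} {u v} → Star R u v → ℂ
    walkGain Φ ε                 = 1ᶜ
    walkGain Φ (_◅_ {i} {j} _ p) = GainGraph.φ Φ i j *ᶜ walkGain Φ p

    -- Suitable orientation directs tree edges away from the root and the
    -- other edges towards it, so the fundamental cycle of a chord runs
    -- along T from lo up to hi and returns from hi to lo on the chord.
    cycleGain : GainGraph G → (T : NormalSpanningTree G) → Chord T → ℂ
    cycleGain Φ T c = walkGain Φ (treeWalk lo hi) *ᶜ GainGraph.φ Φ hi lo
      where open NormalSpanningTree T
            open Chord c

    𝒜 : (T : NormalSpanningTree G) → (Chord T → ℝ) → Pred (GainGraph G) 0ℓ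
    𝒜 T r Φ = ∀ c → cycleGain Φ T c ≡ e^i (r c)

    GNRP : NormalSpanningTree G → Set
    GNRP T = (r : Chord T → ℝ) → (∀ c → r c ∈ₚ 𝕀) →
      ∃[ Φ ] Φ ∈ₚ 𝒜 T r × (∀ s t → 0# ≤ Re (adjacency Φ s t))

  -- The class of connected graphs with GNRP; whether GNRP holds does not
  -- depend on the normal spanning tree, and all of them are required here.
  𝒫 : Pred Graph (suc 0ℓ)
  𝒫 G = Connected G × (∀ T → GNRP {G} T)

{-# OPTIONS --safe #-}
module Submission where

-- Fix T₀ with EDEP.  Choose the gains of the tree edges first; each chord's
-- gain is then forced by the prescribed gain of its fundamental cycle.  If a
-- cycle has a tree edge outside the cycles treated so far, the gain w of that
-- edge can be chosen so that w and the forced gain both have nonnegative real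
-- part, since every z ∈ 𝕋 is a product of two such numbers.  A K₄′ is treated
-- by switching: a subdivision vertex can be given a potential that makes one
-- of its two edges neutral, and for K₄ with neutral edges at one vertex the
-- potentials q₁, q₂, q₃ of the others are explicit in the triangle gains
-- a, b, c, depending on the sign of Re abc and on two of the gains lying in a
-- common half-plane.  Distinct fundamental subgraphs share no tree edge, so
-- their solutions combine.  Another tree T is handled through any gain graph
-- with the required T-cycle gains: two gain graphs that agree on the
-- fundamental cycles of T₀ differ by a potential and so agree on all cycles.

open import Defs
open import Axiom.ExcludedMiddle using (ExcludedMiddle)
open import Level using (0ℓ; suc; Lift; lift; lower)
open import Relation.Unary using (Pred; _⊆_) renaming (_∈_ to _∈ₚ_)

open import Algebra.Bundles using (AbelianGroup; CommutativeRing)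
import Algebra.Properties.AbelianGroup as AbelianGroupProperties
import Algebra.Properties.Ring as RingProperties
import Algebra.Solver.CommutativeMonoid as CommutativeMonoidSolver
import Algebra.Solver.Ring.NaturalCoefficients.Default as SemiringSolver
open import Algebra.Structures using (IsAbelianGroup)
open import Axiom.UniquenessOfIdentityProofs.WithK using (uip)
open import Data.Empty using (⊥; ⊥-elim; ⊥-elim-irr)
import Data.Fin as Fin
open import Data.Fin using (Fin; zero) renaming (suc to fsuc)
open import Data.Fin.Properties using (any?)
open import Data.List using (List; []; _∷_; length; allFin; cartesianProduct)
open import Data.List.Membership.DecPropositional using () renaming (_∈?_ to member?)
open import Data.List.Membership.Propositional using () renaming (_∈_ to _∈ₗ_)
open import Data.List.Membership.Propositional.Properties using (∈-allFin; ∈-cartesianProduct⁺)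
open import Data.List.Properties using (∷-injective; ∷-injectiveʳ)
open import Data.List.Relation.Binary.Subset.Propositional using () renaming (_⊆_ to _⊆ₗ_)
import Data.List.Relation.Unary.All as All
open import Data.List.Relation.Unary.All using (All; []; _∷_)
open import Data.List.Relation.Unary.AllPairs using ([]; _∷_)
open import Data.List.Relation.Unary.Any using (here; there)
open import Data.List.Relation.Unary.Unique.Propositional using (Unique)
open import Data.Nat using (ℕ; z≤n; s≤s) renaming (_+_ to _+ℕ_; _≤_ to _≤ℕ_; _<_ to _<ℕ_)
open import Data.Nat.Properties using (<-asym)
open import Data.Product using (Σ; ∃-syntax; _×_; _,_; proj₁; proj₂)
open import Data.Sum using (_⊎_; inj₁; inj₂; map₂)
open import Data.Vec using (Vec; []; _∷_; lookup)
open import Function using (_∘_)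
open import Function.Bundles using (module Equivalence)
open import Relation.Binary using (Rel; DecidableEquality; Symmetric; Irreflexive; IsTotalOrder)
import Relation.Binary.Construct.Closure.ReflexiveTransitive as Star
open import Relation.Binary.Construct.Closure.ReflexiveTransitive using (Star; _◅_; _◅◅_) renaming (ε to stop)
open import Relation.Binary.PropositionalEquality
  using (_≡_; _≢_; refl; sym; trans; cong; cong₂; subst; subst₂; isEquivalence)
open import Relation.Nullary using (¬_; Dec; yes; no; contradiction; recompute)
open import Relation.Nullary.Decidable using (True; toWitness; fromWitness; map′; _×-dec_)

-- Abelian groups and the unit circle

module AbelianGroupSolver (G : AbelianGroup 0ℓ 0ℓ) where
  open AbelianGroup G renaming (refl to ≈-refl; sym to ≈-sym; trans to ≈-trans)
  open AbelianGroupProperties G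
  private module M = CommutativeMonoidSolver commutativeMonoid
  open import Relation.Binary.Reasoning.Setoid setoid

  infixl 7 _:∙_
  infix  8 _:⁻¹
  data Expr (n : ℕ) : Set where
    var  : Fin n → Expr n
    :ε   : Expr n
    _:∙_ : Expr n → Expr n → Expr n
    _:⁻¹ : Expr n → Expr n

  ⟦_⟧ : ∀ {n} → Expr n → Vec Carrier n → Carrier
  ⟦ var x ⟧  ρ = lookup ρ x
  ⟦ :ε ⟧     ρ = ε
  ⟦ e :∙ f ⟧ ρ = ⟦ e ⟧ ρ ∙ ⟦ f ⟧ ρ
  ⟦ e :⁻¹ ⟧  ρ = ⟦ e ⟧ ρ ⁻¹

  -- Every expression is a quotient of two monoid expressions.
  numerator denominator : ∀ {n} → Expr n → M.Expr n
  numerator (var x)    = M.var x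
  numerator :ε         = M.id
  numerator (e :∙ f)   = numerator e M.⊕ numerator f
  numerator (e :⁻¹)    = denominator e
  denominator (var x)  = M.id
  denominator :ε       = M.id
  denominator (e :∙ f) = denominator e M.⊕ denominator f
  denominator (e :⁻¹)  = numerator e

  private
    interchange⁻¹ : ∀ a b c d → (a ∙ b ⁻¹) ∙ (c ∙ d ⁻¹) ≈ (a ∙ c) ∙ (b ∙ d) ⁻¹
    interchange⁻¹ a b c d = begin
      (a ∙ b ⁻¹) ∙ (c ∙ d ⁻¹)  ≈⟨ M.solve 4 (λ a b c d → (a M.⊕ b) M.⊕ (c M.⊕ d) M.⊜ (a M.⊕ c) M.⊕ (b M.⊕ d))
                                     ≈-refl a (b ⁻¹) c (d ⁻¹) ⟩
      (a ∙ c) ∙ (b ⁻¹ ∙ d ⁻¹)  ≈⟨ ∙-congˡ (⁻¹-∙-comm b d) ⟩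
      (a ∙ c) ∙ (b ∙ d) ⁻¹     ∎

  quotient : ∀ {n} (e : Expr n) ρ →
             ⟦ e ⟧ ρ ≈ M.⟦ numerator e ⟧ ρ ∙ M.⟦ denominator e ⟧ ρ ⁻¹
  quotient (var x) ρ  = ≈-sym (≈-trans (∙-congˡ ε⁻¹≈ε) (identityʳ _))
  quotient :ε ρ       = ≈-sym (inverseʳ ε)
  quotient (e :∙ f) ρ = ≈-trans (∙-cong (quotient e ρ) (quotient f ρ)) (interchange⁻¹ _ _ _ _)
  quotient (e :⁻¹) ρ  = begin
    ⟦ e ⟧ ρ ⁻¹    ≈⟨ ⁻¹-cong (quotient e ρ) ⟩
    (p ∙ q ⁻¹) ⁻¹ ≈⟨ ⁻¹-anti-homo‿- p q ⟩
    q ∙ p ⁻¹      ∎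
    where p = M.⟦ numerator e ⟧ ρ
          q = M.⟦ denominator e ⟧ ρ

  -- Clearing denominators: `a ∙ b ⁻¹` equals `c ∙ d ⁻¹` once `a ∙ d` equals `c ∙ b`, and that is an
  -- identity of commutative monoids, settled by normal forms.
  solve : ∀ {n} (ρ : Vec Carrier n) (e f : Expr n) →
          M.normalise (numerator e M.⊕ denominator f) ≡
          M.normalise (numerator f M.⊕ denominator e) →
          ⟦ e ⟧ ρ ≈ ⟦ f ⟧ ρ
  solve ρ e f eq = begin
    ⟦ e ⟧ ρ                    ≈⟨ quotient e ρ ⟩
    a ∙ b ⁻¹                   ≈⟨ ∙-congʳ (≈-sym (//-rightDividesʳ d a)) ⟩
    (a ∙ d) ∙ d ⁻¹ ∙ b ⁻¹      ≈⟨ ∙-congʳ (∙-congʳ cross) ⟩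
    (c ∙ b) ∙ d ⁻¹ ∙ b ⁻¹      ≈⟨ M.solve 4 (λ c b d b′ → ((c M.⊕ b) M.⊕ d) M.⊕ b′ M.⊜ (b M.⊕ b′) M.⊕ (c M.⊕ d))
                                     ≈-refl c b (d ⁻¹) (b ⁻¹) ⟩
    (b ∙ b ⁻¹) ∙ (c ∙ d ⁻¹)    ≈⟨ ∙-congʳ (inverseʳ b) ⟩
    ε ∙ (c ∙ d ⁻¹)             ≈⟨ identityˡ _ ⟩
    c ∙ d ⁻¹                   ≈⟨ ≈-sym (quotient f ρ) ⟩
    ⟦ f ⟧ ρ                    ∎
    where
    a = M.⟦ numerator e ⟧ ρ
    b = M.⟦ denominator e ⟧ ρ
    c = M.⟦ numerator f ⟧ ρ
    d = M.⟦ denominator f ⟧ ρ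
    cross : a ∙ d ≈ c ∙ b
    cross = begin
      a ∙ d ≈⟨ ≈-sym (M.normalise-correct (numerator e M.⊕ denominator f) ρ) ⟩
      M.⟦ M.normalise (numerator e M.⊕ denominator f) ⟧⇓ ρ
            ≡⟨ cong (λ v → M.⟦ v ⟧⇓ ρ) eq ⟩
      M.⟦ M.normalise (numerator f M.⊕ denominator e) ⟧⇓ ρ
            ≈⟨ M.normalise-correct (numerator f M.⊕ denominator e) ρ ⟩
      c ∙ b ∎

-- The unit circle as far as the argument needs it; Pos z stands for Re z ≥ 0.
record Circle : Set₁ where
  infixl 7 _∙_
  infix  8 _⁻¹
  field
    U              : Set
    _∙_            : U → U → U
    ε              : U
    _⁻¹            : U → U
    isAbelianGroup : IsAbelianGroup _≡_ _∙_ ε _⁻¹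
    i              : U
    i⁴             : (i ∙ i) ∙ (i ∙ i) ≡ ε
    Pos            : U → Set
    Pos-ε          : Pos ε
    Pos-i          : Pos i
    Pos-⁻¹         : ∀ {z} → Pos z → Pos (z ⁻¹)
    Pos-split      : ∀ z → Pos z ⊎ Pos (z ∙ (i ∙ i))

  abelianGroup : AbelianGroup 0ℓ 0ℓ
  abelianGroup = record { isAbelianGroup = isAbelianGroup }

  open IsAbelianGroup isAbelianGroup public
    using (assoc; comm; identityˡ; identityʳ; inverseˡ; inverseʳ)

module CircleProperties (𝒞 : Circle) where
  open Circle 𝒞
  open AbelianGroupSolver abelianGroup public
  open AbelianGroupProperties abelianGroup public using (⁻¹-involutive; ε⁻¹≈ε; inverseˡ-unique)

  v₀ : ∀ {n} → Expr (1 +ℕ n)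
  v₁ : ∀ {n} → Expr (2 +ℕ n)
  v₂ : ∀ {n} → Expr (3 +ℕ n)
  v₃ : ∀ {n} → Expr (4 +ℕ n)
  v₀ = var zero
  v₁ = var (fsuc zero)
  v₂ = var (fsuc (fsuc zero))
  v₃ = var (fsuc (fsuc (fsuc zero)))

  -1# : U
  -1# = i ∙ i

  Right Left Upper Lower : U → Set
  Right   = Pos
  Left z  = Pos (z ∙ -1#)
  Upper z = Pos (z ∙ i ⁻¹)
  Lower z = Pos (z ∙ i)

  right-or-left : ∀ z → Right z ⊎ Left z
  right-or-left = Pos-split

  upper-or-lower : ∀ z → Upper z ⊎ Lower z
  upper-or-lower z = map₂ (subst Pos (solve (z ∷ i ∷ []) (v₀ :∙ v₁ :⁻¹ :∙ (v₁ :∙ v₁)) (v₀ :∙ v₁) refl))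
                          (Pos-split (z ∙ i ⁻¹))

  -1⁻¹ : -1# ≡ -1# ⁻¹
  -1⁻¹ = inverseˡ-unique -1# -1# i⁴

  left-⁻¹ : ∀ {z} → Left z → Left (z ⁻¹)
  left-⁻¹ {z} p = subst Pos (trans (solve (z ∷ -1# ∷ []) ((v₀ :∙ v₁) :⁻¹) (v₀ :⁻¹ :∙ v₁ :⁻¹) refl)
                                   (cong (z ⁻¹ ∙_) (sym -1⁻¹))) (Pos-⁻¹ p)

  -- A quarter turn towards `z` suffices: if `z` is not already in the right half-plane, dividing by
  -- `i` or `i ⁻¹` brings it there, and both of these have real part zero.
  factor : ∀ z → ∃[ w ] Pos w × Pos (w ⁻¹ ∙ z)
  factor z with Pos-split z | upper-or-lower z
  ... | inj₁ p | _      = ε , Pos-ε , subst Pos (solve (z ∷ []) v₀ (:ε :⁻¹ :∙ v₀) refl) p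
  ... | inj₂ _ | inj₁ p = i , Pos-i , subst Pos (comm z (i ⁻¹)) p
  ... | inj₂ _ | inj₂ p = i ⁻¹ , Pos-⁻¹ Pos-i ,
                          subst Pos (solve (z ∷ i ∷ []) (v₀ :∙ v₁) (v₁ :⁻¹ :⁻¹ :∙ v₀) refl) p

  -- Potentials for a K₄ whose three edges at one vertex are neutral and whose remaining triangle
  -- has gains `a`, `b`, `c`. With potential `ε` at that vertex, the first three conditions concern
  -- its edges and the last three the triangle.
  record Balanced₃ (a b c : U) : Set where
    constructor balanced
    field
      q₁ q₂ q₃ : U
      pos₁  : Pos q₁
      pos₂  : Pos q₂
      pos₃  : Pos q₃
      pos₁₂ : Pos (q₁ ∙ a ∙ q₂ ⁻¹)
      pos₂₃ : Pos (q₂ ∙ b ∙ q₃ ⁻¹)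
      pos₃₁ : Pos (q₃ ∙ c ∙ q₁ ⁻¹)

  rotate : ∀ {a b c} → Balanced₃ a b c → Balanced₃ b c a
  rotate (balanced q₁ q₂ q₃ p₁ p₂ p₃ p₁₂ p₂₃ p₃₁) = balanced q₂ q₃ q₁ p₂ p₃ p₁ p₂₃ p₃₁ p₁₂

  private
    -- The edges with gains `b` and `c` become neutral, so the third triangle edge carries the whole
    -- product.
    both-right : ∀ a b c → Right b → Right c → Right (a ∙ b ∙ c) → Balanced₃ a b c
    both-right a b c pb pc pt = balanced c (b ⁻¹) ε pc (Pos-⁻¹ pb) Pos-ε
      (subst Pos (solve (a ∷ b ∷ c ∷ []) (v₀ :∙ v₁ :∙ v₂) (v₂ :∙ v₀ :∙ v₁ :⁻¹ :⁻¹) refl) pt)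
      (subst Pos (solve (b ∷ []) :ε (v₀ :⁻¹ :∙ v₀ :∙ :ε :⁻¹) refl) Pos-ε)
      (subst Pos (solve (c ∷ []) :ε (:ε :∙ v₀ :∙ v₀ :⁻¹) refl) Pos-ε)

    -- As in `both-right`, but `q₁` and `q₂` are negated to lie on the right. The signs cancel on
    -- the edge between them, and `i` at the third vertex turns the other two edges into `i` and
    -- `i ⁻¹`.
    both-left : ∀ a b c → Left b → Left c → Right (a ∙ b ∙ c) → Balanced₃ a b c
    both-left a b c pb pc pt = balanced (c ∙ -1#) (b ⁻¹ ∙ -1#) i pc (left-⁻¹ pb) Pos-i
      (subst Pos (solve (a ∷ b ∷ c ∷ i ∷ []) (v₀ :∙ v₁ :∙ v₂)
                   (v₂ :∙ (v₃ :∙ v₃) :∙ v₀ :∙ (v₁ :⁻¹ :∙ (v₃ :∙ v₃)) :⁻¹) refl) pt)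
      (subst Pos (solve (b ∷ i ∷ []) v₁ (v₀ :⁻¹ :∙ (v₁ :∙ v₁) :∙ v₀ :∙ v₁ :⁻¹) refl) Pos-i)
      (subst Pos (solve (c ∷ i ∷ []) (v₁ :⁻¹) (v₁ :∙ v₀ :∙ (v₀ :∙ (v₁ :∙ v₁)) :⁻¹) refl) (Pos-⁻¹ Pos-i))

    -- Two triangle edges get gain `i`. Two quarter turns in the same direction leave the negated
    -- product on the third edge.
    both-upper : ∀ a b c → Upper b → Upper c → Left (a ∙ b ∙ c) → Balanced₃ a b c
    both-upper a b c pb pc pt = balanced (c ∙ i ⁻¹) (i ∙ b ⁻¹) ε pc
      (subst Pos (solve (b ∷ i ∷ []) ((v₀ :∙ v₁ :⁻¹) :⁻¹) (v₁ :∙ v₀ :⁻¹) refl) (Pos-⁻¹ pb)) Pos-ε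
      (subst Pos (trans (cong (a ∙ b ∙ c ∙_) -1⁻¹)
                 (solve (a ∷ b ∷ c ∷ i ∷ []) (v₀ :∙ v₁ :∙ v₂ :∙ (v₃ :∙ v₃) :⁻¹)
                   (v₂ :∙ v₃ :⁻¹ :∙ v₀ :∙ (v₃ :∙ v₁ :⁻¹) :⁻¹) refl)) pt)
      (subst Pos (solve (b ∷ i ∷ []) v₁ (v₁ :∙ v₀ :⁻¹ :∙ v₀ :∙ :ε :⁻¹) refl) Pos-i)
      (subst Pos (solve (c ∷ i ∷ []) v₁ (:ε :∙ v₀ :∙ (v₀ :∙ v₁ :⁻¹) :⁻¹) refl) Pos-i)

    -- The mirror image of `both-upper`, with two edges of gain `i ⁻¹`.
    both-lower : ∀ a b c → Lower b → Lower c → Left (a ∙ b ∙ c) → Balanced₃ a b c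
    both-lower a b c pb pc pt = balanced (c ∙ i) ((b ∙ i) ⁻¹) ε pc (Pos-⁻¹ pb) Pos-ε
      (subst Pos (solve (a ∷ b ∷ c ∷ i ∷ []) (v₀ :∙ v₁ :∙ v₂ :∙ (v₃ :∙ v₃))
                   (v₂ :∙ v₃ :∙ v₀ :∙ (v₁ :∙ v₃) :⁻¹ :⁻¹) refl) pt)
      (subst Pos (solve (b ∷ i ∷ []) (v₁ :⁻¹) ((v₀ :∙ v₁) :⁻¹ :∙ v₀ :∙ :ε :⁻¹) refl) (Pos-⁻¹ Pos-i))
      (subst Pos (solve (c ∷ i ∷ []) (v₁ :⁻¹) (:ε :∙ v₀ :∙ (v₀ :∙ v₁) :⁻¹) refl) (Pos-⁻¹ Pos-i))

    cyclic : ∀ a b c → a ∙ b ∙ c ≡ b ∙ c ∙ a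
    cyclic a b c = solve (a ∷ b ∷ c ∷ []) (v₀ :∙ v₁ :∙ v₂) (v₁ :∙ v₂ :∙ v₀) refl

    -- Two of the three gains lie in the same half-plane. The product is invariant under cyclic
    -- shifts, so that pair may be moved to the last two places.
    pigeonhole : ∀ {P Q : U → Set} (R : U → Set) → (∀ z → P z ⊎ Q z) →
                 (∀ a b c → P b → P c → R (a ∙ b ∙ c) → Balanced₃ a b c) →
                 (∀ a b c → Q b → Q c → R (a ∙ b ∙ c) → Balanced₃ a b c) →
                 ∀ a b c → R (a ∙ b ∙ c) → Balanced₃ a b c
    pigeonhole {P} {Q} R dec bothP bothQ a b c r = go (dec a) (dec b) (dec c)
      where
      r′ : R (b ∙ c ∙ a)
      r′ = subst R (cyclic a b c) r
      r″ : R (c ∙ a ∙ b)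
      r″ = subst R (cyclic b c a) r′
      go : P a ⊎ Q a → P b ⊎ Q b → P c ⊎ Q c → Balanced₃ a b c
      go _        (inj₁ p) (inj₁ q) = bothP a b c p q r
      go _        (inj₂ p) (inj₂ q) = bothQ a b c p q r
      go (inj₁ o) (inj₁ p) (inj₂ _) = rotate (bothP c a b o p r″)
      go (inj₂ o) (inj₂ p) (inj₁ _) = rotate (bothQ c a b o p r″)
      go (inj₁ o) (inj₂ _) (inj₁ q) = rotate (rotate (bothP b c a q o r′))
      go (inj₂ o) (inj₁ _) (inj₂ q) = rotate (rotate (bothQ b c a q o r′))

  balance₃ : ∀ a b c → Balanced₃ a b c
  balance₃ a b c with right-or-left (a ∙ b ∙ c)
  ... | inj₁ t = pigeonhole Right right-or-left both-right both-left a b c t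
  ... | inj₂ t = pigeonhole Left upper-or-lower both-upper both-lower a b c t

-- Walks, gains and trees

module _ {V : Set} {R : Rel V 0ℓ} where

  start∈ : ∀ {u v} (p : Star R u v) → u ∈ₗ vertices p
  start∈ stop    = here refl
  start∈ (_ ◅ _) = here refl

  end∈ : ∀ {u v} (p : Star R u v) → v ∈ₗ vertices p
  end∈ stop    = here refl
  end∈ (_ ◅ p) = there (end∈ p)

  walkEdges⇒∈ : ∀ {u v} (p : Star R u v) {a b} → walkEdges p a b →
                a ∈ₗ vertices p × b ∈ₗ vertices p
  walkEdges⇒∈ (_ ◅ p) (inj₁ (inj₁ (refl , refl))) = here refl , there (start∈ p)
  walkEdges⇒∈ (_ ◅ p) (inj₁ (inj₂ (refl , refl))) = there (start∈ p) , here refl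
  walkEdges⇒∈ (_ ◅ p) (inj₂ w) with walkEdges⇒∈ p w
  ... | a∈ , b∈ = there a∈ , there b∈

  walkEdges-sym : ∀ {u v} (p : Star R u v) {a b} → walkEdges p a b → walkEdges p b a
  walkEdges-sym (_ ◅ p) (inj₁ (inj₁ (x , y))) = inj₁ (inj₂ (y , x))
  walkEdges-sym (_ ◅ p) (inj₁ (inj₂ (x , y))) = inj₁ (inj₁ (y , x))
  walkEdges-sym (_ ◅ p) (inj₂ w)              = inj₂ (walkEdges-sym p w)

  walkEdges-resp : ∀ {u v} (p : Star R u v) {a b c d} → SameEdge a b c d →
                   walkEdges p a b → walkEdges p c d
  walkEdges-resp p (inj₁ (refl , refl)) w = w
  walkEdges-resp p (inj₂ (refl , refl)) w = walkEdges-sym p w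

  walkEdges⊆ : Symmetric R → ∀ {u v} (p : Star R u v) {a b} → walkEdges p a b → R a b
  walkEdges⊆ R-sym (e ◅ _) (inj₁ (inj₁ (refl , refl))) = e
  walkEdges⊆ R-sym (e ◅ _) (inj₁ (inj₂ (refl , refl))) = R-sym e
  walkEdges⊆ R-sym (_ ◅ p) (inj₂ w)                    = walkEdges⊆ R-sym p w

  -- The initial part of `p` is kept as a walk in the edges of `p` itself, so that it can be carried
  -- over to any relation containing them.
  walkTo : ∀ {s t u} (p : Star R s t) → u ∈ₗ vertices p → Star (walkEdges p) s u
  walkTo stop    (here refl) = stop
  walkTo (_ ◅ p) (here refl) = stop
  walkTo (_ ◅ p) (there u∈)  = inj₁ (inj₁ (refl , refl)) ◅ Star.map inj₂ (walkTo p u∈)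

  vertices-map : ∀ {S : Rel V 0ℓ} (f : ∀ {a b} → R a b → S a b) {u v} (p : Star R u v) →
                 vertices (Star.map f p) ≡ vertices p
  vertices-map f stop    = refl
  vertices-map f (_ ◅ p) = cong (_ ∷_) (vertices-map f p)

  split : ∀ {s t u} (p : Star R s t) → u ∈ₗ vertices p →
          Σ (Star R s u) λ p₁ → Σ (Star R u t) λ p₂ → p ≡ p₁ ◅◅ p₂
  split stop    (here refl) = stop , stop , refl
  split (e ◅ p) (here refl) = stop , e ◅ p , refl
  split (e ◅ p) (there u∈) with split p u∈
  ... | p₁ , p₂ , refl = e ◅ p₁ , p₂ , refl

  vertices-◅◅ˡ : ∀ {s t u} (p : Star R s t) (q : Star R t u) → vertices p ⊆ₗ vertices (p ◅◅ q)
  vertices-◅◅ˡ stop    q (here refl) = start∈ q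
  vertices-◅◅ˡ (_ ◅ p) q (here refl) = here refl
  vertices-◅◅ˡ (_ ◅ p) q (there x∈)  = there (vertices-◅◅ˡ p q x∈)

  vertices-◅◅ʳ : ∀ {s t u} (p : Star R s t) (q : Star R t u) → vertices q ⊆ₗ vertices (p ◅◅ q)
  vertices-◅◅ʳ stop    q x∈ = x∈
  vertices-◅◅ʳ (_ ◅ p) q x∈ = there (vertices-◅◅ʳ p q x∈)

  unique-◅◅ˡ : ∀ {s t u} (p : Star R s t) (q : Star R t u) →
               Unique (vertices (p ◅◅ q)) → Unique (vertices p)
  unique-◅◅ˡ stop    q _       = [] ∷ []
  unique-◅◅ˡ (_ ◅ p) q (x ∷ U) =
    All.tabulate (λ y∈ → All.lookup x (vertices-◅◅ˡ p q y∈)) ∷ unique-◅◅ˡ p q U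

  unique-◅◅ʳ : ∀ {s t u} (p : Star R s t) (q : Star R t u) →
               Unique (vertices (p ◅◅ q)) → Unique (vertices q)
  unique-◅◅ʳ stop    q U       = U
  unique-◅◅ʳ (_ ◅ p) q (_ ∷ U) = unique-◅◅ʳ p q U

  edge-or-long : ∀ {u v} (p : Star R u v) → u ≢ v → ∃[ k ] length (vertices p) ≡ 2 +ℕ k
  edge-or-long stop            u≢v = contradiction refl u≢v
  edge-or-long (_ ◅ stop)      _   = _ , refl
  edge-or-long (_ ◅ (_ ◅ p))   _   = _ , refl

  -- Putting the avoidance of `w` into the relation makes it survive the reduction of walks to
  -- paths.
  avoiding : ∀ {u v w} (p : Star R u v) → All (w ≢_) (vertices p) →
             Star (λ a b → R a b × w ≢ a × w ≢ b) u v
  avoiding stop    _       = stop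
  avoiding (e ◅ p) (x ∷ a) = (e , x , All.lookup a (start∈ p)) ◅ avoiding p a

acyclic-⊆ : ∀ {V : Set} {R S : Rel V 0ℓ} → (∀ {a b} → R a b → S a b) → Acyclic S → Acyclic R
acyclic-⊆ f S-acyclic (p , p-unique) long r =
  S-acyclic (Star.map f p , subst Unique (sym (vertices-map f p)) p-unique)
            (subst (λ l → 3 ≤ℕ length l) (sym (vertices-map f p)) long) (f r)

module Gains (𝒞 : Circle) {V : Set} (_≟_ : DecidableEquality V) where
  open Circle 𝒞
  open CircleProperties 𝒞

  Gain : Set
  Gain = V → V → U

  Antisymmetric : Gain → Set
  Antisymmetric g = ∀ u v → g v u ≡ g u v ⁻¹

  module _ {R : Rel V 0ℓ} where

    gain : Gain → ∀ {u v} → Star R u v → U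
    gain g stop              = ε
    gain g (_◅_ {i} {j} _ p) = g i j ∙ gain g p

    gain-cong : ∀ {g h : Gain} {u v} (p : Star R u v) →
                (∀ a b → walkEdges p a b → g a b ≡ h a b) → gain g p ≡ gain h p
    gain-cong stop    eq = refl
    gain-cong (_ ◅ p) eq =
      cong₂ _∙_ (eq _ _ (inj₁ (inj₁ (refl , refl)))) (gain-cong p λ a b w → eq a b (inj₂ w))

    gain-◅◅ : ∀ g {s t u} (p : Star R s t) (q : Star R t u) →
              gain g (p ◅◅ q) ≡ gain g p ∙ gain g q
    gain-◅◅ g stop    q = sym (identityˡ _)
    gain-◅◅ g (_ ◅ p) q = trans (cong (_ ∙_) (gain-◅◅ g p q)) (sym (assoc _ _ _))

    gain-ratio : ∀ (g h : Gain) {u v} (p : Star R u v) →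
                 gain (λ a b → g a b ∙ h a b ⁻¹) p ≡ gain g p ∙ gain h p ⁻¹
    gain-ratio g h stop = sym (inverseʳ ε)
    gain-ratio g h (_◅_ {i} {j} _ p) = trans (cong (_ ∙_) (gain-ratio g h p))
      (solve (g i j ∷ h i j ∷ gain g p ∷ gain h p ∷ [])
        (v₀ :∙ v₁ :⁻¹ :∙ (v₂ :∙ v₃ :⁻¹)) (v₀ :∙ v₂ :∙ (v₁ :∙ v₃) :⁻¹) refl)

    gain-potential : ∀ (g : Gain) (q : V → U) {u v} (p : Star R u v) →
                     (∀ a b → walkEdges p a b → g a b ≡ q a ∙ q b ⁻¹) →
                     gain g p ≡ q u ∙ q v ⁻¹
    gain-potential g q stop eq = sym (inverseʳ _)
    gain-potential g q {u} {v} (_◅_ {j = j} _ p) eq = trans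
      (cong₂ _∙_ (eq _ _ (inj₁ (inj₁ (refl , refl)))) (gain-potential g q p λ a b w → eq a b (inj₂ w)))
      (solve (q u ∷ q j ∷ q v ∷ []) (v₀ :∙ v₁ :⁻¹ :∙ (v₁ :∙ v₂ :⁻¹)) (v₀ :∙ v₂ :⁻¹) refl)

    -- Adjacency proofs may differ, so walks are compared through their vertex lists, on which alone
    -- the gain depends.
    gain-vertices : ∀ g {u v w} (p : Star R u v) (q : Star R u w) → vertices p ≡ vertices q →
                    gain g p ≡ gain g q
    gain-vertices g stop    stop    eq = refl
    gain-vertices g stop    (_ ◅ stop) ()
    gain-vertices g stop    (_ ◅ (_ ◅ q)) ()
    gain-vertices g (_ ◅ stop) stop ()
    gain-vertices g (_ ◅ (_ ◅ _)) stop ()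
    gain-vertices g (_ ◅ p) (_ ◅ q) eq with heads p q (∷-injectiveʳ eq)
      where
      heads : ∀ {a b c d} (p : Star R a b) (q : Star R c d) → vertices p ≡ vertices q → a ≡ c
      heads stop    stop    refl = refl
      heads stop    (_ ◅ _) eq = proj₁ (∷-injective eq)
      heads (_ ◅ _) stop    eq = proj₁ (∷-injective eq)
      heads (_ ◅ _) (_ ◅ _) eq = proj₁ (∷-injective eq)
    ... | refl = cong (_ ∙_) (gain-vertices g p q (∷-injectiveʳ eq))

  module Forest {R : Rel V 0ℓ} (R-irrefl : Irreflexive _≡_ R) (R-acyclic : Acyclic R) where

    -- Backtracking is the only way in which a walk in a forest fails to be a
    -- path, and it does not contribute to the gain.
    reduce : ∀ {u v} (p : Star R u v) →
             Σ (Path R u v) λ (q , _) → ∀ g → Antisymmetric g → gain g q ≡ gain g p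
    reduce stop = (stop , [] ∷ []) , λ _ _ → refl
    reduce {u} (_◅_ {j = j} e p) with reduce p
    ... | (q , q-unique) , same with member? _≟_ u (vertices q)
    ... | no u∉ = (e ◅ q , All.tabulate (λ { x∈ refl → u∉ x∈ }) ∷ q-unique) ,
                  λ g anti → cong (_ ∙_) (same g anti)
    -- The path `q` comes back to `u`: at once, so that `e` is a loop; after one edge, a backtrack
    -- that cancels; or after a longer path that `e` closes to a cycle.
    ... | yes u∈ with split q u∈
    ... | stop , q₂ , refl = contradiction e (R-irrefl refl)
    ... | e′ ◅ stop , q₂ , refl = (q₂ , unique-◅◅ʳ (e′ ◅ stop) q₂ q-unique) , λ g anti →
            trans (backtrack g anti (gain g q₂)) (cong (g u j ∙_) (same g anti))
      where
      backtrack : ∀ g → Antisymmetric g → ∀ z → z ≡ g u j ∙ (g j u ∙ z)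
      backtrack g anti z = trans
        (solve (z ∷ g u j ∷ []) v₀ (v₁ :∙ (v₁ :⁻¹ :∙ v₀)) refl)
        (cong (λ y → g u j ∙ (y ∙ z)) (sym (anti u j)))
    ... | e′ ◅ (e″ ◅ q₁) , q₂ , refl =
            contradiction e (R-acyclic (e′ ◅ (e″ ◅ q₁) , unique-◅◅ˡ (e′ ◅ (e″ ◅ q₁)) q₂ q-unique)
                              (long q₁))
      where
      long : ∀ {a b} (q : Star R a b) → 3 ≤ℕ 2 +ℕ length (vertices q)
      long stop    = s≤s (s≤s (s≤s z≤n))
      long (_ ◅ _) = s≤s (s≤s (s≤s z≤n))

  module Tree {R : Rel V 0ℓ} (R-sym : Symmetric R) (R-irrefl : Irreflexive _≡_ R)
              (R-acyclic : Acyclic R) where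
    open Forest R-irrefl R-acyclic public

    -- If the paths leave `u` towards different vertices `j` and `k`, their remainders join to a
    -- walk from `j` to `k` that avoids `u`. Reduced to a path without losing this avoidance, it
    -- forms a cycle together with the two edges at `u`.
    unique-path : ∀ {u v} (p q : Star R u v) → Unique (vertices p) → Unique (vertices q) →
                  vertices p ≡ vertices q
    unique-path stop    stop    _       _       = refl
    unique-path stop    (_ ◅ q) _       (x ∷ _) = contradiction refl (All.lookup x (end∈ q))
    unique-path (_ ◅ p) stop    (x ∷ _) _       = contradiction refl (All.lookup x (end∈ p))
    unique-path {u} (_◅_ {j = j} e p) (_◅_ {j = k} f q) (x ∷ p-unique) (y ∷ q-unique) with j ≟ k
    ... | yes refl = cong (u ∷_) (unique-path p q p-unique q-unique)
    ... | no j≢k = contradiction (R-sym f) (R-acyclic (e ◅ r′ , unique) long)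
      where
      R′ : Rel V 0ℓ
      R′ a b = R a b × u ≢ a × u ≢ b
      detour : Path R′ j k
      detour = proj₁ (Forest.reduce {R′} (λ { eq (r , _) → R-irrefl eq r }) (acyclic-⊆ proj₁ R-acyclic)
        (avoiding p x ◅◅ Star.reverse (λ { (r , a , b) → R-sym r , b , a }) (avoiding q y)))
      r = proj₁ detour
      r′ = Star.map proj₁ r
      avoids : ∀ {a b} → u ≢ a → (s : Star R′ a b) → All (u ≢_) (vertices s)
      avoids n stop                = n ∷ []
      avoids n ((_ , _ , m) ◅ s)   = n ∷ avoids m s
      unique : Unique (u ∷ vertices r′)
      unique = subst (λ l → Unique (u ∷ l)) (sym (vertices-map proj₁ r))
                 (avoids (All.lookup x (start∈ p)) r ∷ proj₂ detour)
      long : 3 ≤ℕ length (u ∷ vertices r′)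
      long with edge-or-long r′ j≢k
      ... | k , eq = subst (λ n → 3 ≤ℕ 1 +ℕ n) (sym eq) (s≤s (s≤s (s≤s z≤n)))

    gain-unique : ∀ {g} → Antisymmetric g → ∀ {u v} (p q : Star R u v) → gain g p ≡ gain g q
    gain-unique {g} anti p q with reduce p | reduce q
    ... | (p′ , p′-unique) , p′≡p | (q′ , q′-unique) , q′≡q =
      trans (sym (p′≡p g anti))
        (trans (gain-vertices g p′ q′ (unique-path p′ q′ p′-unique q′-unique)) (q′≡q g anti))

-- Subdivisions of K₄

module _ {V : Set} where

  sameEdge-sym : ∀ {a b c d : V} → SameEdge a b c d → SameEdge c d a b
  sameEdge-sym (inj₁ (refl , refl)) = inj₁ (refl , refl)
  sameEdge-sym (inj₂ (refl , refl)) = inj₂ (refl , refl)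

  sameEdge-flip : ∀ {a b c d : V} → SameEdge a b c d → SameEdge b a c d
  sameEdge-flip (inj₁ (x , y)) = inj₂ (y , x)
  sameEdge-flip (inj₂ (x , y)) = inj₁ (y , x)

  K₄′-sym : {X : Rel V 0ℓ} → K₄′ X → Symmetric X
  K₄′-sym (complete f _ X⇔) x with Equivalence.to (X⇔ _ _) x
  ... | i , j , i≢j , a≡ , b≡ = Equivalence.from (X⇔ _ _) (j , i , (λ j≡i → i≢j (sym j≡i)) , b≡ , a≡)
  K₄′-sym (subdivide k _ _ Y⇔) y with Equivalence.to (Y⇔ _ _) y
  ... | inj₁ (x , n)  = Equivalence.from (Y⇔ _ _) (inj₁ (K₄′-sym k x , λ s → n (sameEdge-flip s)))
  ... | inj₂ (inj₁ s) = Equivalence.from (Y⇔ _ _) (inj₂ (inj₁ (sameEdge-flip s)))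
  ... | inj₂ (inj₂ s) = Equivalence.from (Y⇔ _ _) (inj₂ (inj₂ (sameEdge-flip s)))

  -- A loop at the new vertex `w` would identify it with an end of the subdivided edge, which is
  -- covered.
  K₄′-irrefl : {X : Rel V 0ℓ} → K₄′ X → ∀ {a} → ¬ X a a
  K₄′-irrefl (complete f inj X⇔) x with Equivalence.to (X⇔ _ _) x
  ... | i , j , i≢j , refl , fi≡fj = i≢j (inj fi≡fj)
  K₄′-irrefl (subdivide {u = u} {v} {w} k Xuv w∉X Y⇔) y with Equivalence.to (Y⇔ _ _) y
  ... | inj₁ (x , _)  = K₄′-irrefl k x
  ... | inj₂ (inj₁ (inj₁ (refl , refl))) = w∉X (v , Xuv)
  ... | inj₂ (inj₁ (inj₂ (refl , refl))) = w∉X (v , Xuv)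
  ... | inj₂ (inj₂ (inj₁ (refl , refl))) = w∉X (u , K₄′-sym k Xuv)
  ... | inj₂ (inj₂ (inj₂ (refl , refl))) = w∉X (u , K₄′-sym k Xuv)

-- Local changes of gains, and switching

module Overriding (𝒞 : Circle) {V : Set} (_≟_ : DecidableEquality V) where
  open Circle 𝒞
  open CircleProperties 𝒞
  open Gains 𝒞 _≟_

  -- `P` selects one orientation of each edge to be changed; the opposite orientation gets the
  -- inverse. This serves both for a single edge and for all chords at once, where the new value
  -- depends on the chord found.
  module Override (P : V → V → Set) (P? : ∀ u v → Dec (P u v)) (h : ∀ u v → P u v → U) (g : Gain) where

    override : Gain
    override u v with P? u v | P? v u
    ... | yes x | _     = h u v x
    ... | no _  | yes x = h v u x ⁻¹
    ... | no _  | no _  = g u v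

    override-antisym : (∀ {u v} → P u v → ¬ P v u) → Antisymmetric g → Antisymmetric override
    override-antisym asym anti u v with P? u v | P? v u
    ... | yes x | yes y = contradiction y (asym x)
    ... | yes x | no _  = refl
    ... | no _  | yes x = sym (⁻¹-involutive _)
    ... | no _  | no _  = anti u v

    override-in : ∀ {u v} (x : P u v) → (∀ y → h u v y ≡ h u v x) → override u v ≡ h u v x
    override-in {u} {v} x irr with P? u v | P? v u
    ... | yes y | _ = irr y
    ... | no ¬x | _ = contradiction x ¬x

    override-out : ∀ {u v} → ¬ P u v → ¬ P v u → override u v ≡ g u v
    override-out {u} {v} ¬x ¬y with P? u v | P? v u
    ... | yes x | _     = contradiction x ¬x
    ... | no _  | yes y = contradiction y ¬y
    ... | no _  | no _  = refl

    override-Pos : (∀ u v x → Pos (h u v x)) → (∀ u v → Pos (g u v)) → ∀ u v → Pos (override u v)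
    override-Pos hp gp u v with P? u v | P? v u
    ... | yes x | _     = hp u v x
    ... | no _  | yes x = Pos-⁻¹ (hp v u x)
    ... | no _  | no _  = gp u v

  module Update (a b : V) (z : U) (g : Gain) =
    Override (λ u v → u ≡ a × v ≡ b) (λ u v → (u ≟ a) ×-dec (v ≟ b)) (λ _ _ _ → z) g

  update : Gain → V → V → U → Gain
  update g a b z = Update.override a b z g

  update-antisym : ∀ {g a b z} → a ≢ b → Antisymmetric g → Antisymmetric (update g a b z)
  update-antisym {g} {a} {b} {z} a≢b =
    Update.override-antisym a b z g λ { (refl , refl) (b≡a , _) → a≢b (sym b≡a) }

  update-at : ∀ {g a b z} → update g a b z a b ≡ z
  update-at {g} {a} {b} {z} = Update.override-in a b z g (refl , refl) λ _ → refl

  update-off : ∀ {g a b z u v} → ¬ SameEdge u v a b → update g a b z u v ≡ g u v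
  update-off {g} {a} {b} {z} n = Update.override-out a b z g (λ x → n (inj₁ x)) (λ (y , x) → n (inj₂ (x , y)))

  update-Pos : ∀ {g a b z} → Pos z → (∀ u v → Pos (g u v)) → ∀ u v → Pos (update g a b z u v)
  update-Pos {g} {a} {b} {z} pz = Update.override-Pos a b z g λ _ _ _ → pz

  module _ {R : Rel V 0ℓ} where

    gain-update-off : ∀ {g a b z u v} (p : Star R u v) → ¬ walkEdges p a b →
                      gain (update g a b z) p ≡ gain g p
    gain-update-off p n = gain-cong p λ c d w → update-off λ s → n (walkEdges-resp p s w)

    -- A path crosses the edge only once, so its gain is a constant times the new gain of that edge,
    -- taken in the direction `i` to `j` in which the path runs.
    gain-update-on : ∀ g {a b u v} (p : Star R u v) → Unique (vertices p) → walkEdges p a b →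
      ∃[ i ] ∃[ j ] R i j × walkEdges p i j × SameEdge a b i j ×
      ∃[ k ] (∀ z → gain (update g i j z) p ≡ k ∙ z)
    gain-update-on g (_◅_ {i} {j} e p) (x ∷ _) (inj₁ s) =
      i , j , e , inj₁ (inj₁ (refl , refl)) , s , gain g p , λ z →
        trans (cong₂ _∙_ update-at (gain-update-off p λ w → All.lookup x (proj₁ (walkEdges⇒∈ p w)) refl))
              (comm z _)
    gain-update-on g (_◅_ {k} {l} e p) (x ∷ p-unique) (inj₂ w) with gain-update-on g p p-unique w
    ... | i , j , f , w′ , s , c , eq =
      i , j , f , inj₂ w′ , s , g k l ∙ c , λ z →
        trans (cong₂ _∙_ (update-off off) (eq z)) (sym (assoc _ _ _))
      where
      off : ¬ SameEdge k l i j
      off (inj₁ (refl , refl)) = All.lookup x (proj₁ (walkEdges⇒∈ p w′)) refl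
      off (inj₂ (refl , refl)) = All.lookup x (proj₂ (walkEdges⇒∈ p w′)) refl

  switched : (V → U) → Gain → Gain
  switched p g a b = p a ∙ g a b ∙ p b ⁻¹

  -- All antisymmetric gains are quantified over because undoing a subdivision changes the gain.
  Balanceable : Rel V 0ℓ → Set
  Balanceable X = ∀ g → Antisymmetric g → ∃[ p ] ∀ a b → X a b → Pos (switched p g a b)

  Pos-flip : ∀ x {y y′} z → y′ ≡ y ⁻¹ → Pos (x ∙ y ∙ z ⁻¹) → Pos (z ∙ y′ ∙ x ⁻¹)
  Pos-flip x {y} z refl pos = subst Pos
    (solve (x ∷ y ∷ z ∷ []) ((v₀ :∙ v₁ :∙ v₂ :⁻¹) :⁻¹) (v₂ :∙ v₁ :⁻¹ :∙ v₀ :⁻¹) refl) (Pos-⁻¹ pos)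

  K₄′-balanceable : {X : Rel V 0ℓ} → K₄′ X → Balanceable X
  K₄′-balanceable {X} (complete f inj X⇔) g anti = p , λ a b x → on-edge a b (Equivalence.to (X⇔ a b) x)
    where
    -- Switching makes the edges at f 0 neutral; the remaining triangle is
    -- balanced by q₁, q₂, q₃ inside the right half-plane.
    g₀ : Fin 4 → Fin 4 → U
    g₀ j k = g (f j) (f k)
    1# 2# 3# : Fin 4
    1# = fsuc zero
    2# = fsuc (fsuc zero)
    3# = fsuc (fsuc (fsuc zero))
    triangle : Fin 4 → Fin 4 → U
    triangle j k = g₀ zero j ∙ g₀ j k ∙ g₀ zero k ⁻¹
    open Balanced₃ (balance₃ (triangle 1# 2#) (triangle 2# 3#) (triangle 3# 1#))
    p₀ : Fin 4 → U
    p₀ zero = ε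
    p₀ (fsuc zero) = q₁ ∙ g₀ zero 1#
    p₀ (fsuc (fsuc zero)) = q₂ ∙ g₀ zero 2#
    p₀ (fsuc (fsuc (fsuc zero))) = q₃ ∙ g₀ zero 3#
    -- Vertices outside the image of `f` get the default `ε`; no edge of `X` meets them.
    p : V → U
    p v with any? (λ k → f k ≟ v)
    ... | yes (k , _) = p₀ k
    ... | no _        = ε
    p-f : ∀ k → p (f k) ≡ p₀ k
    p-f k with any? (λ j → f j ≟ f k)
    ... | yes (_ , eq) = cong p₀ (inj eq)
    ... | no n         = contradiction (k , refl) n
    spoke : ∀ q k → Pos q → Pos (ε ∙ g₀ zero k ∙ (q ∙ g₀ zero k) ⁻¹)
    spoke q k pos = subst Pos
      (solve (q ∷ g₀ zero k ∷ []) (v₀ :⁻¹) (:ε :∙ v₁ :∙ (v₀ :∙ v₁) :⁻¹) refl) (Pos-⁻¹ pos)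
    rim : ∀ q r j k → Pos (q ∙ triangle j k ∙ r ⁻¹) →
          Pos (q ∙ g₀ zero j ∙ g₀ j k ∙ (r ∙ g₀ zero k) ⁻¹)
    rim q r j k = subst Pos (solve (q ∷ r ∷ g₀ zero j ∷ g₀ j k ∷ g₀ zero k ∷ [])
      (v₀ :∙ (v₂ :∙ v₃ :∙ v₄ :⁻¹) :∙ v₁ :⁻¹) (v₀ :∙ v₂ :∙ v₃ :∙ (v₁ :∙ v₄) :⁻¹) refl)
      where v₄ = var (fsuc (fsuc (fsuc (fsuc zero))))
    flip : ∀ j k → Pos (p₀ j ∙ g₀ j k ∙ p₀ k ⁻¹) → Pos (p₀ k ∙ g₀ k j ∙ p₀ j ⁻¹)
    flip j k = Pos-flip (p₀ j) (p₀ k) (anti _ _)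
    all : ∀ j k → j ≢ k → Pos (p₀ j ∙ g₀ j k ∙ p₀ k ⁻¹)
    all zero zero n = contradiction refl n
    all zero (fsuc zero) _ = spoke q₁ 1# pos₁
    all zero (fsuc (fsuc zero)) _ = spoke q₂ 2# pos₂
    all zero (fsuc (fsuc (fsuc zero))) _ = spoke q₃ 3# pos₃
    all (fsuc zero) zero _ = flip zero 1# (spoke q₁ 1# pos₁)
    all (fsuc zero) (fsuc zero) n = contradiction refl n
    all (fsuc zero) (fsuc (fsuc zero)) _ = rim q₁ q₂ 1# 2# pos₁₂
    all (fsuc zero) (fsuc (fsuc (fsuc zero))) _ = flip 3# 1# (rim q₃ q₁ 3# 1# pos₃₁)
    all (fsuc (fsuc zero)) zero _ = flip zero 2# (spoke q₂ 2# pos₂)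
    all (fsuc (fsuc zero)) (fsuc zero) _ = flip 1# 2# (rim q₁ q₂ 1# 2# pos₁₂)
    all (fsuc (fsuc zero)) (fsuc (fsuc zero)) n = contradiction refl n
    all (fsuc (fsuc zero)) (fsuc (fsuc (fsuc zero))) _ = rim q₂ q₃ 2# 3# pos₂₃
    all (fsuc (fsuc (fsuc zero))) zero _ = flip zero 3# (spoke q₃ 3# pos₃)
    all (fsuc (fsuc (fsuc zero))) (fsuc zero) _ = rim q₃ q₁ 3# 1# pos₃₁
    all (fsuc (fsuc (fsuc zero))) (fsuc (fsuc zero)) _ = flip 2# 3# (rim q₂ q₃ 2# 3# pos₂₃)
    all (fsuc (fsuc (fsuc zero))) (fsuc (fsuc (fsuc zero))) n = contradiction refl n
    on-edge : ∀ a b → ∃[ j ] ∃[ k ] j ≢ k × a ≡ f j × b ≡ f k → Pos (switched p g a b)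
    on-edge _ _ (j , k , j≢k , refl , refl) =
      subst Pos (sym (cong₂ (λ y z → y ∙ g (f j) (f k) ∙ z ⁻¹) (p-f j) (p-f k))) (all j k j≢k)
  K₄′-balanceable {Y} (subdivide {X} {u = u} {v} {w} k Xuv w∉X Y⇔) g anti =
    p , λ a b y → on-edge (Equivalence.to (Y⇔ a b) y)
    where
    u≢v : u ≢ v
    u≢v refl = K₄′-irrefl k Xuv
    -- The two edges through `w` are contracted to the edge from `u` to `v`, which receives their
    -- product.
    g′ : Gain
    g′ = update g u v (g u w ∙ g w v)
    IH = K₄′-balanceable k g′ (update-antisym u≢v anti)
    p₀ = proj₁ IH
    -- The potential at `w` makes the edge from `u` to `w` neutral; the edge from `w` to `v` then
    -- carries the switched gain of the contracted edge.
    p : V → U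
    p x with x ≟ w
    ... | yes _ = p₀ u ∙ g u w
    ... | no _  = p₀ x
    p-w : p w ≡ p₀ u ∙ g u w
    p-w with w ≟ w
    ... | yes _ = refl
    ... | no n  = contradiction refl n
    p-X : ∀ {x y} → X x y → p x ≡ p₀ x
    p-X {x} {y} xy with x ≟ w
    ... | yes refl = contradiction (y , xy) w∉X
    ... | no _     = refl
    uw : Pos (switched p g u w)
    uw = subst Pos (sym (trans (cong₂ (λ y z → y ∙ g u w ∙ z ⁻¹) (p-X Xuv) p-w) (inverseʳ _))) Pos-ε
    wv : Pos (switched p g w v)
    wv = subst Pos (trans (cong (λ y → p₀ u ∙ y ∙ p₀ v ⁻¹) update-at)
           (trans (cong (_∙ p₀ v ⁻¹) (sym (assoc _ _ _)))
             (sym (cong₂ (λ y z → y ∙ g w v ∙ z ⁻¹) p-w (p-X (K₄′-sym k Xuv))))))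
           (proj₂ IH u v Xuv)
    on-edge : ∀ {a b} → (X a b × ¬ SameEdge a b u v) ⊎ SameEdge a b u w ⊎ SameEdge a b w v →
              Pos (switched p g a b)
    on-edge {a} {b} (inj₁ (x , n)) = subst Pos
      (trans (cong (λ y → p₀ a ∙ y ∙ p₀ b ⁻¹) (update-off n))
             (sym (cong₂ (λ y z → y ∙ g a b ∙ z ⁻¹) (p-X x) (p-X (K₄′-sym k x)))))
      (proj₂ IH a b x)
    on-edge (inj₂ (inj₁ (inj₁ (refl , refl)))) = uw
    on-edge (inj₂ (inj₁ (inj₂ (refl , refl)))) = Pos-flip _ _ (anti _ _) uw
    on-edge (inj₂ (inj₂ (inj₁ (refl , refl)))) = wv
    on-edge (inj₂ (inj₂ (inj₂ (refl , refl)))) = Pos-flip _ _ (anti _ _) wv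

-- Realising the gains of the fundamental cycles

module _ {V : Set} {R : Rel V 0ℓ} where

  first-edge : ∀ {u v} (p : Star R u v) → u ≢ v → ∃[ a ] ∃[ b ] walkEdges p a b
  first-edge stop    u≢v = contradiction refl u≢v
  first-edge (_ ◅ _) _   = _ , _ , inj₁ (inj₁ (refl , refl))

  length-◅◅ : ∀ {s t u v} (p : Star R s t) (e : R t u) (q : Star R u v) →
              length (vertices p) <ℕ length (vertices (p ◅◅ (e ◅ q)))
  length-◅◅ stop    e stop    = s≤s (s≤s z≤n)
  length-◅◅ stop    e (_ ◅ _) = s≤s (s≤s z≤n)
  length-◅◅ (_ ◅ p) e q       = s≤s (length-◅◅ p e q)

module WithTree (em : ExcludedMiddle (suc 0ℓ)) (𝒞 : Circle) {G : Graph} (T : NormalSpanningTree G) where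
  open Circle 𝒞
  open CircleProperties 𝒞
  open Graph G renaming (sym to ~-sym)
  open NormalSpanningTree T
  open Chord
  open Gains 𝒞 {V} Fin._≟_
  open Overriding 𝒞 {V} Fin._≟_

  decide : (A : Set) → Dec A
  decide A = map′ lower lift (em {Lift (suc 0ℓ) A})

  T-irrefl : Irreflexive _≡_ _~ᵀ_
  T-irrefl eq e = irrefl eq (subset e)

  open Tree symᵀ T-irrefl acyclic

  -- The part up to `x` of the path from the root to `y` has the vertices of the path to `x`, by
  -- uniqueness of paths. It is strictly shorter unless `x` is `y`, which makes the tree order
  -- antisymmetric.
  ≤ᵀ⇒≡⊎< : ∀ {x y} → x ≤ᵀ y →
    x ≡ y ⊎ length (vertices (treeWalk root x)) <ℕ length (vertices (treeWalk root y))
  ≤ᵀ⇒≡⊎< {x} {y} x≤y with treeWalk root y | proj₂ (path root y) | x≤y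
  ... | p | p-unique | x∈p with split p x∈p
  ... | p₁ , stop , refl = inj₁ refl
  ... | p₁ , e ◅ p₂ , refl = inj₂ (subst (λ l → length l <ℕ length (vertices (p₁ ◅◅ (e ◅ p₂))))
          (unique-path p₁ (treeWalk root x) (unique-◅◅ˡ p₁ (e ◅ p₂) p-unique) (proj₂ (path root x)))
          (length-◅◅ p₁ e p₂))

  ≤ᵀ-antisym : ∀ {x y} → x ≤ᵀ y → y ≤ᵀ x → x ≡ y
  ≤ᵀ-antisym x≤y y≤x with ≤ᵀ⇒≡⊎< x≤y | ≤ᵀ⇒≡⊎< y≤x
  ... | inj₁ eq | _       = eq
  ... | inj₂ _  | inj₁ eq = sym eq
  ... | inj₂ x< | inj₂ y< = contradiction y< (<-asym x<)

  chordWalk : (c : Chord T) → Star _~ᵀ_ (lo c) (hi c)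
  chordWalk c = treeWalk (lo c) (hi c)

  lo≢hi : (c : Chord T) → lo c ≢ hi c
  lo≢hi (chord _ _ e _ _) eq = ⊥-elim-irr (irrefl eq e)

  hi~lo : (c : Chord T) → hi c ~ lo c
  hi~lo (chord lo hi e _ _) = ~-sym (recompute (lo ~? hi) e)

  -- The suitable orientation runs through a chord from hi to lo.
  ClosedBy : V → V → Set
  ClosedBy u v = Σ (Chord T) λ c → hi c ≡ u × lo c ≡ v

  closedBy-unique : ∀ {u v} (x y : ClosedBy u v) → proj₁ x ≡ proj₁ y
  closedBy-unique (chord _ _ _ _ _ , refl , refl) (chord _ _ _ _ _ , refl , refl) = refl

  closedBy-asym : ∀ {u v} → ClosedBy u v → ¬ ClosedBy v u
  closedBy-asym (chord _ _ e _ l , refl , refl) (chord _ _ _ _ l′ , refl , refl) =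
    ⊥-elim-irr (irrefl (≤ᵀ-antisym l l′) e)

  closedBy⇒¬~ᵀ : ∀ {u v} → ClosedBy u v → ¬ v ~ᵀ u
  closedBy⇒¬~ᵀ (chord _ _ _ n _ , refl , refl) e = ⊥-elim-irr (n e)

  -- Normality enters here: it makes the ends of a non-tree edge comparable, which gives the chord
  -- its orientation.
  ~⇒closedBy : ∀ {u v} → u ~ v → ¬ u ~ᵀ v → ClosedBy u v ⊎ ClosedBy v u
  ~⇒closedBy u~v n with normal u~v
  ... | inj₁ u≤v = inj₂ (chord _ _ u~v n u≤v , refl , refl)
  ... | inj₂ v≤u = inj₁ (chord _ _ (~-sym u~v) (n ∘ symᵀ) v≤u , refl , refl)

  module Extend (g : Chord T → U) (x : Gain) =
    Override ClosedBy (λ u v → decide (ClosedBy u v)) (λ _ _ c → g (proj₁ c)) x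

  extend : (Chord T → U) → Gain → Gain
  extend g x = Extend.override g x

  extend-antisym : ∀ g {x} → Antisymmetric x → Antisymmetric (extend g x)
  extend-antisym g {x} = Extend.override-antisym g x closedBy-asym

  extend-chord : ∀ g {x} c → extend g x (hi c) (lo c) ≡ g c
  extend-chord g {x} c = Extend.override-in g x (c , refl , refl)
    λ y → cong g (closedBy-unique y (c , refl , refl))

  extend-tree : ∀ g {x u v} → u ~ᵀ v → extend g x u v ≡ x u v
  extend-tree g {x} e = Extend.override-out g x (λ c → closedBy⇒¬~ᵀ c (symᵀ e)) (λ c → closedBy⇒¬~ᵀ c e)

  gain-extend : ∀ g {x u v} (p : Star _~ᵀ_ u v) → gain (extend g x) p ≡ gain x p
  gain-extend g p = gain-cong p λ _ _ w → extend-tree g (walkEdges⊆ symᵀ p w)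

  cycle-sym : ∀ c → Symmetric (cycle T c)
  cycle-sym c (inj₁ w) = inj₁ (walkEdges-sym (chordWalk c) w)
  cycle-sym c (inj₂ s) = inj₂ (sameEdge-flip s)

  -- The chord is the only edge of the cycle that is not on its tree walk, so of two distinct edges
  -- outside `B` one lies on the walk.
  new-tree-edge : ∀ {B} c → MoreThanOneEdge (cycle T c ∖ B) →
                  ∃[ a ] ∃[ b ] walkEdges (chordWalk c) a b × ¬ B a b
  new-tree-edge c (a , b , _ , _ , (inj₁ w , n) , _ , _) = a , b , w , n
  new-tree-edge c (_ , _ , a , b , _ , (inj₁ w , n) , _) = a , b , w , n
  new-tree-edge c (_ , _ , _ , _ , (inj₂ (inj₁ (refl , refl)) , _) , (inj₂ s , _) , ≢) =
    contradiction (sameEdge-sym s) ≢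
  new-tree-edge c (_ , _ , _ , _ , (inj₂ (inj₂ (refl , refl)) , _) , (inj₂ s , _) , ≢) =
    contradiction (sameEdge-flip (sameEdge-sym s)) ≢

  Within : Rel V 0ℓ → Pred (Chord T) 0ℓ
  Within X c = ∀ a b → cycle T c a b → X a b

  module Realisation (z : Chord T → U) where

    -- The gain of hi → lo that completes x to the prescribed fundamental gain.
    chordGain : Gain → Chord T → U
    chordGain x c = gain x (chordWalk c) ⁻¹ ∙ z c

    -- The problem in terms of the tree gains alone: chord gains are forced, so only the signs of
    -- their real parts remain to be controlled.
    record Solves (x : Gain) (D : Pred (Chord T) 0ℓ) : Set where
      constructor solves
      field
        antisym : Antisymmetric x
        pos     : ∀ u v → Pos (x u v)
        pos-hi  : ∀ {c} → D c → Pos (chordGain x c)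
    open Solves

    Solvable : Pred (Chord T) 0ℓ → Set
    Solvable D = ∃[ x ] Solves x D

    solvable-⊆ : ∀ {D E : Pred (Chord T) 0ℓ} → E ⊆ D → Solvable D → Solvable E
    solvable-⊆ E⊆D (x , solves a p q) = x , solves a p (q ∘ E⊆D)

    solvable-∅ : Solvable (λ _ → ⊥)
    solvable-∅ = (λ _ _ → ε) , solves (λ _ _ → sym ε⁻¹≈ε) (λ _ _ → Pos-ε) ⊥-elim

    chordGain-cong : ∀ {x y} c → (∀ a b → walkEdges (chordWalk c) a b → x a b ≡ y a b) →
                     chordGain x c ≡ chordGain y c
    chordGain-cong c eq = cong (λ k → k ⁻¹ ∙ z c) (gain-cong (chordWalk c) eq)

    -- A tree edge outside B is free: its gain is chosen such that it and the
    -- gain that it forces on the chord c share the required value.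
    add-cycle : ∀ {B : Rel V 0ℓ} {D} c → D ⊆ Within B →
                ∃[ a ] ∃[ b ] walkEdges (chordWalk c) a b × ¬ B a b →
                Solvable D → Solvable (λ d → D d ⊎ d ≡ c)
    add-cycle {B} {D} c D⊆B (a , b , w , n) (x , x-solves)
      with gain-update-on x (chordWalk c) (proj₂ (path (lo c) (hi c))) w
    -- With gain `y` on the free edge the walk has gain `k ∙ y`, which forces `y ⁻¹ ∙ (k ⁻¹ ∙ z c)`
    -- on the chord.
    ... | i , j , e , _ , s , k , gain-k with factor (k ⁻¹ ∙ z c)
    ... | y , pos-y , pos-y′ = update x i j y , record
      { antisym = update-antisym (λ i≡j → T-irrefl i≡j e) (antisym x-solves)
      ; pos     = update-Pos pos-y (pos x-solves)
      ; pos-hi  = λ { (inj₁ d∈D) → old d∈D ; (inj₂ refl) → new }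
      }
      where
      old : ∀ {d} → D d → Pos (chordGain (update x i j y) d)
      old {d} d∈D = subst (λ g → Pos (g ⁻¹ ∙ z d))
        (sym (gain-update-off (chordWalk d) λ v → n (D⊆B d∈D a b
          (inj₁ (walkEdges-resp (chordWalk d) (sameEdge-sym s) v)))))
        (pos-hi x-solves d∈D)
      new : Pos (chordGain (update x i j y) c)
      new = subst Pos
        (trans (solve (k ∷ y ∷ z c ∷ []) (v₁ :⁻¹ :∙ (v₀ :⁻¹ :∙ v₂)) ((v₀ :∙ v₁) :⁻¹ :∙ v₂) refl)
               (cong (λ g → g ⁻¹ ∙ z c) (sym (gain-k y))))
        pos-y′

    -- `B` accumulates the cycles already treated. As those of `D` stay within `B`, a tree edge
    -- outside `B` can be changed without affecting them.
    add-cycles : ∀ cs {B D} → Distinguished T B cs →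
                 D ⊆ Within B →
                 Solvable D → Solvable (λ d → D d ⊎ d ∈ₗ cs)
    add-cycles []       _           _   = solvable-⊆ λ { (inj₁ d∈D) → d∈D }
    add-cycles (c ∷ cs) {B} {D} (two , dist) D⊆B s = solvable-⊆ regroup
      (add-cycles cs dist D⊆B′ (add-cycle c D⊆B (new-tree-edge c two) s))
      where
      D⊆B′ : (λ d → D d ⊎ d ≡ c) ⊆ Within (B ⊕ cycle T c)
      D⊆B′ (inj₁ d∈D) a b w  = inj₁ (D⊆B d∈D a b w)
      D⊆B′ (inj₂ refl) _ _ w = inj₂ w
      regroup : ∀ {d} → D d ⊎ d ∈ₗ (c ∷ cs) → (D d ⊎ d ≡ c) ⊎ d ∈ₗ cs
      regroup (inj₁ d∈D)         = inj₁ (inj₁ d∈D)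
      regroup (inj₂ (here eq))   = inj₁ (inj₂ eq)
      regroup (inj₂ (there d∈)) = inj₂ d∈

    solvable-DEP : ∀ {S} → DEP T S → Solvable S
    solvable-DEP (cs , (_ , cs⇔S) , dist) =
      solvable-⊆ (λ {d} d∈S → Equivalence.from (cs⇔S d) d∈S) (go cs dist)
      where
      go : ∀ cs → DistinguishedFromFirst T cs → Solvable (_∈ₗ cs)
      go []       _    = solvable-⊆ (λ ()) solvable-∅
      -- Nothing precedes the first cycle, so any edge of its tree walk is free; `B` is empty here.
      go (c ∷ cs) dist with first-edge (chordWalk c) (lo≢hi c)
      ... | a , b , w = solvable-⊆ (λ { (here eq) → inj₁ (inj₂ eq) ; (there d∈) → inj₂ d∈ })
        (add-cycles cs dist (λ { (inj₂ refl) _ _ v → v })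
          (add-cycle {λ _ _ → ⊥} c (λ ()) (a , b , w , λ ()) solvable-∅))

    -- Neutral tree edges and chord gains `z` realise the prescribed cycle gains. Switching
    -- preserves them, and balancing `X` brings its edges into the right half-plane. The switched
    -- tree gains are the quotients `p u ∙ p v ⁻¹`; pairs that are not tree edges in `X` keep `ε`.
    solvable-balanceable : ∀ {X : Rel V 0ℓ} → Symmetric X → Balanceable X →
                           Solvable (Within X)
    solvable-balanceable {X} X-sym balance with balance (extend z (λ _ _ → ε))
                                                  (extend-antisym z λ _ _ → sym ε⁻¹≈ε)
    ... | p , p-pos = x , solves x-antisym x-pos x-pos-hi
      where
      x : Gain
      x u v with decide (X u v × u ~ᵀ v)
      ... | yes _ = p u ∙ p v ⁻¹
      ... | no _  = ε
      x-in : ∀ {u v} → X u v → u ~ᵀ v → x u v ≡ p u ∙ p v ⁻¹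
      x-in {u} {v} xuv e with decide (X u v × u ~ᵀ v)
      ... | yes _ = refl
      ... | no n  = contradiction (xuv , e) n
      x-antisym : Antisymmetric x
      x-antisym u v with decide (X u v × u ~ᵀ v) | decide (X v u × v ~ᵀ u)
      ... | yes _       | yes _       = solve (p u ∷ p v ∷ []) (v₁ :∙ v₀ :⁻¹) ((v₀ :∙ v₁ :⁻¹) :⁻¹) refl
      ... | yes (y , e) | no n        = contradiction (X-sym y , symᵀ e) n
      ... | no n        | yes (y , e) = contradiction (X-sym y , symᵀ e) n
      ... | no _        | no _        = sym ε⁻¹≈ε
      x-pos : ∀ u v → Pos (x u v)
      x-pos u v with decide (X u v × u ~ᵀ v)
      ... | yes (y , e) = subst Pos
        (trans (cong (λ k → p u ∙ k ∙ p v ⁻¹) (extend-tree z e)) (cong (_∙ p v ⁻¹) (identityʳ _)))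
        (p-pos u v y)
      ... | no _  = Pos-ε
      x-pos-hi : ∀ {c} → Within X c → Pos (chordGain x c)
      x-pos-hi {c} c⊆X = subst Pos
        (trans (cong (λ k → p (hi c) ∙ k ∙ p (lo c) ⁻¹) (extend-chord z c))
        (trans (solve (p (lo c) ∷ p (hi c) ∷ z c ∷ []) (v₁ :∙ v₂ :∙ v₀ :⁻¹) ((v₀ :∙ v₁ :⁻¹) :⁻¹ :∙ v₂) refl)
               (cong (λ k → k ⁻¹ ∙ z c) (sym (gain-potential x p (chordWalk c) λ a b w →
                 x-in (c⊆X a b (inj₁ w)) (walkEdges⊆ symᵀ (chordWalk c) w))))))
        (p-pos (hi c) (lo c) (c⊆X _ _ (inj₂ (inj₂ (refl , refl)))))

    solvable-DEP-K₄′ : ∀ {S} → DEP-K₄′ T S → Solvable S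
    solvable-DEP-K₄′ {S} (c₁ , c₂ , c₃ , triple , cs , (_ , cs⇔) , dist) = solvable-⊆ classify
      (add-cycles cs dist (λ c⊆X → c⊆X)
        (solvable-balanceable (K₄′-sym sum-K₄′) (K₄′-balanceable sum-K₄′)))
      where
      open K₄′-Triple triple
      classify : ∀ {d} → S d → Within (sum₃ T c₁ c₂ c₃) d ⊎ d ∈ₗ cs
      classify {d} d∈S with decide (d ≡ c₁) | decide (d ≡ c₂) | decide (d ≡ c₃)
      ... | yes refl | _        | _        = inj₁ (λ _ _ → inj₁)
      ... | no _     | yes refl | _        = inj₁ (λ _ _ → inj₂ ∘ inj₁)
      ... | no _     | no _     | yes refl = inj₁ (λ _ _ → inj₂ ∘ inj₂)
      ... | no ≢₁    | no ≢₂    | no ≢₃    = inj₂ (Equivalence.from (cs⇔ d) (d∈S , ≢₁ , ≢₂ , ≢₃))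

    solvable-fundamental : EDEP T → ∀ {S} → IsFundamental T S → Solvable S
    solvable-fundamental edep {S} fund with em {K₄′-Initiated T S}
    ... | yes k = solvable-DEP-K₄′ (proj₁ (edep S fund) k)
    ... | no ¬k = solvable-DEP (proj₂ (edep S fund) ¬k)

  -- Maximal collections of fundamental cycles

  trace : Pred (Chord T) 0ℓ → Rel V 0ℓ
  trace S = sum T S ∩ᴱ _~ᵀ_

  trace-sym : ∀ {S} → Symmetric (trace S)
  trace-sym ((c , c∈S , w) , e) = (c , c∈S , cycle-sym c w) , symᵀ e

  trace-mono : ∀ {S S′ : Pred (Chord T) 0ℓ} → S ⊆ S′ → ∀ {a b} → trace S a b → trace S′ a b
  trace-mono S⊆S′ ((c , c∈S , w) , e) = (c , S⊆S′ c∈S , w) , e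

  walk⊆trace : ∀ {S : Pred (Chord T) 0ℓ} {c} → S c → ∀ {a b} → walkEdges (chordWalk c) a b → trace S a b
  walk⊆trace {c = c} c∈S w = (c , c∈S , inj₁ w) , walkEdges⊆ symᵀ (chordWalk c) w

  trace⇒walk : ∀ {c a b} → cycle T c a b → a ~ᵀ b → walkEdges (chordWalk c) a b
  trace⇒walk (inj₁ w) _ = w
  trace⇒walk {chord _ _ _ n _} (inj₂ (inj₁ (refl , refl))) e = ⊥-elim-irr (n e)
  trace⇒walk {chord _ _ _ n _} (inj₂ (inj₂ (refl , refl))) e = ⊥-elim-irr (n (symᵀ e))

  -- A trace inherits acyclicity from `T`, so only connectedness is at stake; walks through the hub
  -- `o` reduce to paths in this forest.
  meets-from-hub : ∀ {S} o → (∀ {u} → Covers (trace S) u → Star (trace S) u o) → MeetsInSubtree T S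
  meets-from-hub {S} o to-hub =
    (λ cu cv → proj₁ (reduce-S (to-hub cu ◅◅ Star.reverse trace-sym (to-hub cv)))) ,
    acyclic-S
    where
    acyclic-S : Acyclic (trace S)
    acyclic-S = acyclic-⊆ proj₂ acyclic
    reduce-S : ∀ {u v} (p : Star (trace S) u v) → _
    reduce-S = Forest.reduce {R = trace S} (λ eq e → T-irrefl eq (proj₂ e)) acyclic-S

  to-lo : ∀ {S : Pred (Chord T) 0ℓ} {c u v} → S c → cycle T c u v → u ~ᵀ v → Star (trace S) u (lo c)
  to-lo {S} {c} c∈S w e = Star.reverse trace-sym (Star.map (walk⊆trace {S} c∈S)
    (walkTo (chordWalk c) (proj₁ (walkEdges⇒∈ (chordWalk c) (trace⇒walk {c} w e)))))

  covers-lo : ∀ {S : Pred (Chord T) 0ℓ} {c} → S c → Covers (trace S) (lo c)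
  covers-lo {S} {c} c∈S with chordWalk c | lo≢hi c | (λ {a b} → walk⊆trace {S} {c} c∈S {a} {b})
  ... | stop  | lo≢hi | _ = contradiction refl lo≢hi
  ... | _ ◅ _ | _     | f = _ , f (inj₁ (inj₁ (refl , refl)))

  Joint : Chord T → Chord T → Set₁
  Joint c d = ∃[ S ] MeetsInSubtree T S × S c × S d

  -- The largest set through c that meets T in a subtree; excluded middle
  -- brings it down to the universe of predicates on chords.
  class : Chord T → Pred (Chord T) 0ℓ
  class c d = True (em {Joint c d})

  joint⇒class : ∀ {c d} → Joint c d → class c d
  joint⇒class = fromWitness

  meets-singleton : ∀ c → MeetsInSubtree T (_≡ c)
  meets-singleton c = meets-from-hub (lo c) λ { (_ , (_ , refl , w) , e) → to-lo {_≡ c} refl w e }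

  class-refl : ∀ c → class c c
  class-refl c = joint⇒class ((_≡ c) , meets-singleton c , refl , refl)

  -- Each chord of the class shares with `c` a set `S` whose trace is a subtree. All of `S` lies in
  -- the class, so the path to `lo c` inside that subtree stays in the trace of the class.
  class-to-lo : ∀ c {u} → Covers (trace (class c)) u → Star (trace (class c)) u (lo c)
  class-to-lo c {u} (v , (d , d∈ , w) , e) with toWitness d∈
  ... | S , meets , c∈S , d∈S = Star.map
    (trace-mono {S} {class c} λ {e} e∈S → joint⇒class (S , meets , c∈S , e∈S))
    (proj₁ (proj₁ meets (v , (d , d∈S , w) , e) (covers-lo {S} c∈S)))

  class-meets : ∀ c → MeetsInSubtree T (class c)
  class-meets c = meets-from-hub (lo c) (class-to-lo c)

  -- Maximality: a larger set that meets `T` in a subtree contains `c`, hence is itself a witness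
  -- that its chords belong to the class.
  class-fundamental : ∀ c → IsFundamental T (class c)
  class-fundamental c = class-meets c ,
    λ S′ class⊆S′ meets d∈S′ → joint⇒class (S′ , meets , class⊆S′ (class-refl c) , d∈S′)

  -- The shared tree edge keeps the trace connected when `d` is adjoined to the class, so the
  -- enlarged set witnesses that `d` was in it already.
  class-absorbs : ∀ {c d a b} → trace (class c) a b → walkEdges (chordWalk d) a b → class c d
  class-absorbs {c} {d} {a} {b} t w = joint⇒class
    (S , meets-from-hub (lo c) to-hub , inj₁ (class-refl c) , inj₂ refl)
    where
    S : Pred (Chord T) 0ℓ
    S e = class c e ⊎ e ≡ d
    class-part : ∀ {u} → Covers (trace (class c)) u → Star (trace S) u (lo c)
    class-part cov = Star.map (trace-mono {class c} {S} inj₁) (class-to-lo c cov)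
    to-hub : ∀ {u} → Covers (trace S) u → Star (trace S) u (lo c)
    to-hub (v , (e , inj₁ e∈ , w′) , f) = class-part (v , (e , e∈ , w′) , f)
    -- The route goes to `lo d`, along the tree walk of `d` to the end `a` of the shared edge, and
    -- from there within the class to `lo c`.
    to-hub (v , (e , inj₂ refl , w′) , f) = to-lo {S} (inj₂ refl) w′ f
      ◅◅ Star.reverse trace-sym (to-lo {S} (inj₂ refl) (inj₁ w) (proj₂ t))
      ◅◅ class-part (b , t)

  module _ (z : Chord T → U) where
    open Realisation z
    open Solves

    -- Fundamental subgraphs share no tree edge, so their solutions combine.
    merge : ∀ {c D} → Solvable (class c) → Solvable D → Solvable (λ d → class c d ⊎ D d)
    merge {c} {D} (x , x-solves) (y , y-solves) = m , solves m-antisym m-pos m-pos-hi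
      where
      m : Gain
      m u v with decide (trace (class c) u v)
      ... | yes _ = x u v
      ... | no _  = y u v
      m-in : ∀ {u v} → trace (class c) u v → m u v ≡ x u v
      m-in {u} {v} t with decide (trace (class c) u v)
      ... | yes _ = refl
      ... | no n  = contradiction t n
      m-out : ∀ {u v} → ¬ trace (class c) u v → m u v ≡ y u v
      m-out {u} {v} n with decide (trace (class c) u v)
      ... | yes t = contradiction t n
      ... | no _  = refl
      m-antisym : Antisymmetric m
      m-antisym u v with decide (trace (class c) u v) | decide (trace (class c) v u)
      ... | yes _ | yes _ = antisym x-solves u v
      ... | yes t | no n  = contradiction (trace-sym t) n
      ... | no n  | yes t = contradiction (trace-sym t) n
      ... | no _  | no _  = antisym y-solves u v
      m-pos : ∀ u v → Pos (m u v)
      m-pos u v with decide (trace (class c) u v)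
      ... | yes _ = pos x-solves u v
      ... | no _  = pos y-solves u v
      m-pos-hi : ∀ {d} → class c d ⊎ D d → Pos (chordGain m d)
      -- A chord of the class sees only values of `x`, even if it is also in `D`. By `class-absorbs`
      -- any other chord has no tree edge in the trace and sees only values of `y`.
      m-pos-hi {d} d∈ with decide (class c d) | d∈
      ... | yes d∈c | _        = subst Pos
        (sym (chordGain-cong d λ _ _ w → m-in (walk⊆trace {class c} d∈c w))) (pos-hi x-solves d∈c)
      ... | no d∉c  | inj₁ d∈c = contradiction d∈c d∉c
      ... | no d∉c  | inj₂ d∈D = subst Pos
        (sym (chordGain-cong d λ _ _ w → m-out λ t → d∉c (class-absorbs t w))) (pos-hi y-solves d∈D)

    -- The chords are exhausted through the finite list of vertex pairs; each chord met brings in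
    -- the solution of its whole fundamental subgraph.
    solvable-all : EDEP T → ∃[ x ] Antisymmetric x × (∀ u v → Pos (x u v)) × ∀ c → Pos (chordGain x c)
    solvable-all edep with go (cartesianProduct (allFin order) (allFin order))
      where
      Ends∈ : List (V × V) → Pred (Chord T) 0ℓ
      Ends∈ L c = (hi c , lo c) ∈ₗ L
      go : ∀ L → Solvable (Ends∈ L)
      go [] = solvable-⊆ (λ ()) solvable-∅
      go ((u , v) ∷ L) with decide (ClosedBy u v)
      ... | no n = solvable-⊆
        (λ { {c} (here refl) → contradiction (c , refl , refl) n ; (there d∈) → d∈ }) (go L)
      ... | yes (c , refl , refl) = solvable-⊆
        (λ { {d} (here eq) → inj₁ (subst (class c)
                 (closedBy-unique (c , refl , refl) (d , cong proj₁ eq , cong proj₂ eq)) (class-refl c))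
           ; (there d∈) → inj₂ d∈ })
        (merge (solvable-fundamental edep (class-fundamental c)) (go L))
    ... | x , solves a p h = x , a , p , λ c → h (∈-cartesianProduct⁺ (∈-allFin (hi c)) (∈-allFin (lo c)))

-- Independence of the spanning tree

module Agreement (em : ExcludedMiddle (suc 0ℓ)) (𝒞 : Circle) {G : Graph} (T : NormalSpanningTree G) where
  open Circle 𝒞
  open CircleProperties 𝒞
  open Graph G renaming (sym to ~-sym)
  open NormalSpanningTree T
  open Chord
  open Gains 𝒞 {V} Fin._≟_
  open WithTree em 𝒞 T
  open Tree symᵀ T-irrefl acyclic

  module _ {g h : Gain} (g-antisym : Antisymmetric g) (h-antisym : Antisymmetric h)
           (agree : ∀ c → gain g (chordWalk c) ∙ g (hi c) (lo c) ≡
                          gain h (chordWalk c) ∙ h (hi c) (lo c)) where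

    ratio : Gain
    ratio u v = g u v ∙ h u v ⁻¹

    ratio-antisym : Antisymmetric ratio
    ratio-antisym u v = trans (cong₂ (λ x y → x ∙ y ⁻¹) (g-antisym u v) (h-antisym u v))
      (solve (g u v ∷ h u v ∷ []) (v₀ :⁻¹ :∙ v₁ :⁻¹ :⁻¹) ((v₀ :∙ v₁ :⁻¹) :⁻¹) refl)

    potential : V → U
    potential v = gain ratio (treeWalk root v) ⁻¹

    -- The root path of `u` followed by the edge is a tree walk to `v`, and all tree walks to `v`
    -- from the root have the same gain, whichever way the edge runs.
    ratio-tree : ∀ {u v} → u ~ᵀ v → ratio u v ≡ potential u ∙ potential v ⁻¹
    ratio-tree {u} {v} e = trans
      (solve (ratio u v ∷ gain ratio (treeWalk root u) ∷ []) v₀ (v₁ :⁻¹ :∙ (v₁ :∙ (v₀ :∙ :ε)) :⁻¹ :⁻¹) refl)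
      (cong (λ k → potential u ∙ k ⁻¹ ⁻¹)
        (trans (sym (gain-◅◅ ratio (treeWalk root u) (e ◅ stop)))
               (gain-unique ratio-antisym (treeWalk root u ◅◅ (e ◅ stop)) (treeWalk root v))))

    ratio-cycle : ∀ c → gain ratio (chordWalk c) ∙ ratio (hi c) (lo c) ≡ ε
    ratio-cycle c = trans (cong (_∙ ratio (hi c) (lo c)) (gain-ratio g h (chordWalk c)))
      (trans (solve (gain g (chordWalk c) ∷ gain h (chordWalk c) ∷ g (hi c) (lo c) ∷ h (hi c) (lo c) ∷ [])
               (v₀ :∙ v₁ :⁻¹ :∙ (v₂ :∙ v₃ :⁻¹)) ((v₀ :∙ v₂) :∙ (v₁ :∙ v₃) :⁻¹) refl)
      (trans (cong (_∙ (gain h (chordWalk c) ∙ h (hi c) (lo c)) ⁻¹) (agree c)) (inverseʳ _)))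

    ratio-chord : ∀ c → ratio (hi c) (lo c) ≡ potential (hi c) ∙ potential (lo c) ⁻¹
    ratio-chord c = trans
      (solve (ratio (hi c) (lo c) ∷ k ∷ l ∷ []) v₀ ((v₁ :∙ v₂) :⁻¹ :∙ v₁ :⁻¹ :⁻¹ :∙ (v₂ :∙ v₀)) refl)
      (trans (cong₂ (λ x y → x ⁻¹ ∙ potential (lo c) ⁻¹ ∙ y)
               (trans (sym (gain-◅◅ ratio (treeWalk root (lo c)) (chordWalk c)))
                      (gain-unique ratio-antisym (treeWalk root (lo c) ◅◅ chordWalk c) (treeWalk root (hi c))))
               (ratio-cycle c))
             (identityʳ _))
      where
      k = gain ratio (treeWalk root (lo c))
      l = gain ratio (chordWalk c)

    ratio-potential : ∀ {u v} → u ~ v → ratio u v ≡ potential u ∙ potential v ⁻¹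
    ratio-potential {u} {v} u~v with decide (u ~ᵀ v)
    ... | yes e = ratio-tree e
    ... | no n with ~⇒closedBy u~v n
    ... | inj₁ (c , refl , refl) = ratio-chord c
    ... | inj₂ (c , refl , refl) = trans (ratio-antisym v u) (trans (cong _⁻¹ (ratio-chord c))
      (solve (potential u ∷ potential v ∷ []) ((v₁ :∙ v₀ :⁻¹) :⁻¹) (v₀ :∙ v₁ :⁻¹) refl))

    -- On every edge of the graph the ratio is a quotient of potentials, so it telescopes to `ε`
    -- around a closed walk.
    closed-walks-agree : ∀ {R : Rel V 0ℓ} → Symmetric R → (∀ {u v} → R u v → u ~ v) →
      ∀ {u v} (p : Star R u v) → v ~ u → gain g p ∙ g v u ≡ gain h p ∙ h v u
    closed-walks-agree R-sym R⊆~ {u} {v} p v~u = trans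
      (solve (gain g p ∷ g v u ∷ gain h p ∷ h v u ∷ [])
        (v₀ :∙ v₁) (((v₀ :∙ v₂ :⁻¹) :∙ (v₁ :∙ v₃ :⁻¹)) :∙ (v₂ :∙ v₃)) refl)
      (trans (cong (_∙ (gain h p ∙ h v u)) (trans
        (cong₂ _∙_
          (trans (sym (gain-ratio g h p))
                 (gain-potential ratio potential p λ a b w → ratio-potential (R⊆~ (walkEdges⊆ R-sym p w))))
          (ratio-potential v~u))
        (solve (potential u ∷ potential v ∷ []) (v₀ :∙ v₁ :⁻¹ :∙ (v₁ :∙ v₀ :⁻¹)) :ε refl)))
        (identityˡ _))

module _ (em : ExcludedMiddle (suc 0ℓ)) (𝒞 : Circle) {G : Graph} (T₀ T : NormalSpanningTree G) where
  open Circle 𝒞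
  open CircleProperties 𝒞
  open Graph G renaming (sym to ~-sym)
  open Gains 𝒞 {V} Fin._≟_
  open Chord
  private
    module T₀ = WithTree em 𝒞 T₀
    module T where
      open NormalSpanningTree T public
      open WithTree em 𝒞 T public

  gain-ε : ∀ {R : Rel V 0ℓ} {u v} (p : Star R u v) → gain (λ _ _ → ε) p ≡ ε
  gain-ε stop    = refl
  gain-ε (_ ◅ p) = trans (identityˡ _) (gain-ε p)

  EDEP⇒realisable : EDEP T₀ → (z : Chord T → U) →
    ∃[ g ] Antisymmetric g × (∀ u v → Pos (g u v)) ×
      ∀ c → gain g (T.chordWalk c) ∙ g (hi c) (lo c) ≡ z c
  EDEP⇒realisable edep z = transfer (T₀.solvable-all z₀ edep)
    where
    -- Only the gains of Ψ along the fundamental cycles of T₀ matter: they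
    -- determine its gain along every cycle.
    Ψ : Gain
    Ψ = T.extend z (λ _ _ → ε)
    Ψ-antisym : Antisymmetric Ψ
    Ψ-antisym = T.extend-antisym z (λ _ _ → sym ε⁻¹≈ε)
    z₀ : Chord T₀ → U
    z₀ c = gain Ψ (T₀.chordWalk c) ∙ Ψ (hi c) (lo c)
    open T₀.Realisation z₀ using (chordGain)
    transfer : ∃[ x ] Antisymmetric x × (∀ u v → Pos (x u v)) × (∀ c → Pos (chordGain x c)) →
      ∃[ g ] Antisymmetric g × (∀ u v → Pos (g u v)) ×
        ∀ c → gain g (T.chordWalk c) ∙ g (hi c) (lo c) ≡ z c
    transfer (x , x-antisym , x-pos , hi-pos) = Φ , Φ-antisym ,
      T₀.Extend.override-Pos (chordGain x) x (λ _ _ y → hi-pos (proj₁ y)) x-pos ,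
      -- On a cycle of `T`, `Φ` agrees with `Ψ`, which is neutral along the tree part and has gain
      -- `z c` on the chord.
      λ c → trans
        (Agreement.closed-walks-agree em 𝒞 T₀ Φ-antisym Ψ-antisym agree T.symᵀ T.subset
          (T.chordWalk c) (T.hi~lo c))
        (trans (cong₂ _∙_ (trans (T.gain-extend z (T.chordWalk c)) (gain-ε (T.chordWalk c)))
                          (T.extend-chord z c))
               (identityˡ (z c)))
      where
      Φ : Gain
      Φ = T₀.extend (chordGain x) x
      Φ-antisym : Antisymmetric Φ
      Φ-antisym = T₀.extend-antisym (chordGain x) x-antisym
      agree : ∀ c → gain Φ (T₀.chordWalk c) ∙ Φ (hi c) (lo c) ≡ z₀ c
      agree c = trans
        (cong₂ _∙_ (T₀.gain-extend (chordGain x) (T₀.chordWalk c)) (T₀.extend-chord (chordGain x) c))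
        (solve (gain x (T₀.chordWalk c) ∷ z₀ c ∷ []) (v₀ :∙ (v₀ :⁻¹ :∙ v₁)) v₁ refl)

-- The real and complex numbers

module UnitCircle (ℛ : RealNumbers) where
  open RealNumbers ℛ

  commutativeRing : CommutativeRing 0ℓ 0ℓ
  commutativeRing = record { isCommutativeRing = isCommutativeRing }

  private
    module R = CommutativeRing commutativeRing
    module RP = RingProperties R.ring
    open SemiringSolver R.commutativeSemiring using (solve; _:=_; _:+_; _:*_)

    open IsTotalOrder isTotalOrder using (total) renaming (refl to ≤-refl)

    m : ℝ
    m = - 1#

    abstract
      -- The products below are semiring identities once -1 is a variable m;
      -- negation enters only through m * m ≡ 1 and 1 + m ≡ 0.
      m*m : m * m ≡ 1#
      m*m = trans (RP.-1*x≈-x m) (RP.-‿involutive 1#)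

      *ᶜ-def : ∀ a b c d → (a , b) *ᶜ (c , d) ≡ (a * c + m * (b * d) , a * d + b * c)
      *ᶜ-def a b c d = cong (λ x → a * c + x , a * d + b * c) (sym (RP.-1*x≈-x (b * d)))

      *ᶜ-assoc : ∀ x y z → (x *ᶜ y) *ᶜ z ≡ x *ᶜ (y *ᶜ z)
      *ᶜ-assoc (a , b) (c , d) (e , f) =
        trans (cong (_*ᶜ (e , f)) (*ᶜ-def a b c d)) (trans (*ᶜ-def _ _ e f) (trans
          (cong₂ _,_
            (solve 7 (λ a b c d e f m →
              (a :* c :+ m :* (b :* d)) :* e :+ m :* ((a :* d :+ b :* c) :* f) :=
              a :* (c :* e :+ m :* (d :* f)) :+ m :* (b :* (c :* f :+ d :* e))) refl a b c d e f m)
            (solve 7 (λ a b c d e f m →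
              (a :* c :+ m :* (b :* d)) :* f :+ (a :* d :+ b :* c) :* e :=
              a :* (c :* f :+ d :* e) :+ b :* (c :* e :+ m :* (d :* f))) refl a b c d e f m))
          (sym (trans (cong ((a , b) *ᶜ_) (*ᶜ-def c d e f)) (*ᶜ-def a b _ _)))))

      *ᶜ-comm : ∀ x y → x *ᶜ y ≡ y *ᶜ x
      *ᶜ-comm (a , b) (c , d) = cong₂ _,_
        (cong₂ (λ x y → x + - y) (R.*-comm a c) (R.*-comm b d))
        (trans (R.+-comm _ _) (cong₂ _+_ (R.*-comm b c) (R.*-comm a d)))

      real*ᶜ : ∀ s a b → (s , 0#) *ᶜ (a , b) ≡ (s * a , s * b)
      real*ᶜ s a b = cong₂ _,_
        (trans (cong (λ x → s * a + - x) (R.zeroˡ b)) (trans (cong (s * a +_) RP.-0#≈0#) (R.+-identityʳ _)))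
        (trans (cong (s * b +_) (R.zeroˡ a)) (R.+-identityʳ _))

      *ᶜ-identityˡ : ∀ z → 1ᶜ *ᶜ z ≡ z
      *ᶜ-identityˡ (a , b) = trans (real*ᶜ 1# a b) (cong₂ _,_ (R.*-identityˡ a) (R.*-identityˡ b))

      𝕋-*ᶜ : ∀ z w → 𝕋 z → 𝕋 w → 𝕋 (z *ᶜ w)
      𝕋-*ᶜ (a , b) (c , d) ab cd =
        trans (cong (λ { (x , y) → x * x + y * y }) (*ᶜ-def a b c d)) (trans
          (solve 5 (λ a b c d m →
            (a :* c :+ m :* (b :* d)) :* (a :* c :+ m :* (b :* d)) :+ (a :* d :+ b :* c) :* (a :* d :+ b :* c) :=
            a :* a :* (c :* c) :+ m :* m :* (b :* b :* (d :* d)) :+ a :* a :* (d :* d) :+ b :* b :* (c :* c)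
              :+ (a :* b :* c :* d :+ a :* b :* c :* d :+ m :* (a :* b :* c :* d :+ a :* b :* c :* d)))
            refl a b c d m) (trans
          (cong₂ (λ x y → a * a * (c * c) + x * (b * b * (d * d)) + a * a * (d * d) + b * b * (c * c) + y)
            m*m (cancel _)) (trans
          (R.+-identityʳ _) (trans
          (cong (λ x → a * a * (c * c) + x + a * a * (d * d) + b * b * (c * c)) (R.*-identityˡ _)) (trans
          (solve 4 (λ a b c d →
            a :* a :* (c :* c) :+ b :* b :* (d :* d) :+ a :* a :* (d :* d) :+ b :* b :* (c :* c) :=
            (a :* a :+ b :* b) :* (c :* c :+ d :* d)) refl a b c d)
          (trans (cong₂ _*_ ab cd) (R.*-identityˡ 1#)))))))
        where
        cancel : ∀ x → x + m * x ≡ 0#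
        cancel x = trans (cong (x +_) (RP.-1*x≈-x x)) (R.-‿inverseʳ x)

      𝕋-1 : 𝕋 1ᶜ
      𝕋-1 = trans (cong₂ _+_ (R.*-identityˡ 1#) (R.zeroˡ 0#)) (R.+-identityʳ 1#)

      𝕋-i : 𝕋 (0# , 1#)
      𝕋-i = trans (cong₂ _+_ (R.zeroˡ 0#) (R.*-identityˡ 1#)) (R.+-identityˡ 1#)

      𝕋-conj : ∀ {a b} → 𝕋 (a , b) → 𝕋 (a , - b)
      𝕋-conj {a} {b} = trans (cong (a * a +_) (trans (sym (RP.-‿distribˡ-* b (- b)))
        (trans (cong -_ (sym (RP.-‿distribʳ-* b b))) (RP.-‿involutive _))))

      -- Membership in `𝕋` is an equation between reals, and proofs of such equations are unique.
      𝕋-≡ : {x y : Σ ℂ 𝕋} → proj₁ x ≡ proj₁ y → x ≡ y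
      𝕋-≡ {z , p} {.z , q} refl = cong (z ,_) (uip p q)

      conj-inverse : ∀ a b → 𝕋 (a , b) → (a , - b) *ᶜ (a , b) ≡ 1ᶜ
      conj-inverse a b ab = cong₂ _,_
        (trans (cong (a * a +_) (trans (cong -_ (sym (RP.-‿distribˡ-* b b))) (RP.-‿involutive _))) ab)
        (trans (cong₂ _+_ (R.*-comm a b) (sym (RP.-‿distribˡ-* b a))) (R.-‿inverseʳ _))

      i*i : (0# , 1#) *ᶜ (0# , 1#) ≡ (m , 0#)
      i*i = cong₂ _,_
        (trans (cong₂ (λ x y → x + - y) (R.zeroˡ 0#) (R.*-identityˡ 1#)) (R.+-identityˡ m))
        (trans (cong₂ _+_ (R.zeroˡ 1#) (R.zeroʳ 1#)) (R.+-identityʳ 0#))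

      0≤-x : ∀ {x} → x ≤ 0# → 0# ≤ - x
      0≤-x {x} x≤0 = subst₂ _≤_ (R.-‿inverseʳ x) (R.+-identityˡ (- x)) (+-monoˡ-≤ (- x) x≤0)

      0≤1 : 0# ≤ 1#
      0≤1 with total 0# 1#
      ... | inj₁ p = p
      -- Here -1 is nonnegative, and therefore so is its square 1.
      ... | inj₂ p = subst (0# ≤_) m*m (*-nonNeg (0≤-x p) (0≤-x p))

      Re-neg : ∀ a b → Re ((a , b) *ᶜ ((0# , 1#) *ᶜ (0# , 1#))) ≡ - a
      Re-neg a b = cong Re (trans (*ᶜ-comm (a , b) _) (trans (cong (_*ᶜ (a , b)) i*i)
        (trans (real*ᶜ m a b) (cong (_, m * b) (RP.-1*x≈-x a)))))

  Unit : Set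
  Unit = Σ ℂ 𝕋

  infixl 7 _*ᵁ_
  _*ᵁ_ : Unit → Unit → Unit
  z *ᵁ w = proj₁ z *ᶜ proj₁ w , 𝕋-*ᶜ (proj₁ z) (proj₁ w) (proj₂ z) (proj₂ w)

  1ᵁ iᵁ : Unit
  1ᵁ = 1ᶜ , 𝕋-1
  iᵁ = (0# , 1#) , 𝕋-i

  conj : Unit → Unit
  conj ((a , b) , ab) = (a , - b) , 𝕋-conj ab

  abstract
    isAbelianGroup : IsAbelianGroup _≡_ _*ᵁ_ 1ᵁ conj
    isAbelianGroup = record
      { isGroup = record
        { isMonoid = record
          { isSemigroup = record
            { isMagma = record { isEquivalence = isEquivalence ; ∙-cong = cong₂ _*ᵁ_ }
            ; assoc = λ x y z → 𝕋-≡ (*ᶜ-assoc (proj₁ x) (proj₁ y) (proj₁ z))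
            }
          ; identity = *ᵁ-identityˡ , λ z → trans (*ᵁ-comm z 1ᵁ) (*ᵁ-identityˡ z)
          }
        ; inverse = *ᵁ-inverseˡ , λ z → trans (*ᵁ-comm z (conj z)) (*ᵁ-inverseˡ z)
        ; ⁻¹-cong = cong conj
        }
      ; comm = *ᵁ-comm
      }
      where
      *ᵁ-comm : ∀ z w → z *ᵁ w ≡ w *ᵁ z
      *ᵁ-comm z w = 𝕋-≡ (*ᶜ-comm (proj₁ z) (proj₁ w))
      *ᵁ-identityˡ : ∀ z → 1ᵁ *ᵁ z ≡ z
      *ᵁ-identityˡ z = 𝕋-≡ (*ᶜ-identityˡ (proj₁ z))
      *ᵁ-inverseˡ : ∀ z → conj z *ᵁ z ≡ 1ᵁ
      *ᵁ-inverseˡ ((a , b) , ab) = 𝕋-≡ (conj-inverse a b ab)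

    i⁴ : (iᵁ *ᵁ iᵁ) *ᵁ (iᵁ *ᵁ iᵁ) ≡ 1ᵁ
    i⁴ = 𝕋-≡ (trans (cong₂ _*ᶜ_ i*i i*i) (trans (real*ᶜ m m 0#) (cong₂ _,_ m*m (R.zeroʳ m))))

  circle : Circle
  circle = record
    { U              = Unit
    ; _∙_            = _*ᵁ_
    ; ε              = 1ᵁ
    ; _⁻¹            = conj
    ; isAbelianGroup = isAbelianGroup
    ; i              = iᵁ
    ; i⁴             = i⁴
    ; Pos            = λ z → 0# ≤ Re (proj₁ z)
    ; Pos-ε          = 0≤1
    ; Pos-i          = ≤-refl
    ; Pos-⁻¹         = λ p → p
    ; Pos-split      = λ ((a , b) , _) →
        map₂ (λ a≤0 → subst (0# ≤_) (sym (Re-neg a b)) (0≤-x a≤0)) (total 0# a)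
    }

  -- The subtraction formula for the cosine at equal arguments is the Pythagorean identity.
  e^i∈𝕋 : ∀ c → 𝕋 (e^i c)
  e^i∈𝕋 c = trans (sym (cos-minus c c)) (trans (cong cos (R.-‿inverseʳ c)) cos-0)

-- From gains on the circle to complex gain graphs

module _ (ℛ : RealNumbers) {G : Graph} where
  open RealNumbers ℛ
  open UnitCircle ℛ
  open Circle circle using (U; _∙_; inverseˡ)
  open Graph G
  open Gains circle {V} Fin._≟_

  gainGraph : (g : Gain) → Antisymmetric g → GainGraph ℛ G
  gainGraph g anti = record
    { φ     = λ u v → proj₁ (g u v)
    ; φ∈𝕋   = λ {u} {v} _ → proj₂ (g u v)
    ; φ-inv = λ {u} {v} _ → cong proj₁ (trans (cong (_∙ g u v) (anti u v)) (inverseˡ (g u v)))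
    }

  walkGain≡gain : ∀ {g} (anti : Antisymmetric g) {R : Rel V 0ℓ} {u v} (p : Star R u v) →
                  walkGain ℛ (gainGraph g anti) p ≡ proj₁ (gain g p)
  walkGain≡gain anti stop    = refl
  walkGain≡gain {g} anti (_◅_ {i} {j} _ p) = cong (proj₁ (g i j) *ᶜ_) (walkGain≡gain anti p)

  module _ (T : NormalSpanningTree G) where
    open NormalSpanningTree T
    open Chord

    gainGraph∈𝒜 : ∀ {g} (anti : Antisymmetric g) (r : Chord T → ℝ) →
      (∀ c → gain g (treeWalk (lo c) (hi c)) ∙ g (hi c) (lo c) ≡ (e^i (r c) , e^i∈𝕋 (r c))) →
      gainGraph g anti ∈ₚ 𝒜 ℛ T r
    gainGraph∈𝒜 {g} anti r cycles c = trans
      (cong (_*ᶜ proj₁ (g (hi c) (lo c))) (walkGain≡gain anti (treeWalk (lo c) (hi c))))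
      (cong proj₁ (cycles c))

  adjacency-nonneg : ∀ {g} (anti : Antisymmetric g) → (∀ u v → 0# ≤ Re (proj₁ (g u v))) →
                     ∀ s t → 0# ≤ Re (adjacency ℛ (gainGraph g anti) s t)
  adjacency-nonneg anti pos s t with s ~? t
  ... | yes _ = pos s t
  ... | no _  = IsTotalOrder.refl isTotalOrder

  EDEP⇒GNRP : ExcludedMiddle (suc 0ℓ) → ∀ {T₀ : NormalSpanningTree G} → EDEP T₀ → ∀ T → GNRP ℛ T
  EDEP⇒GNRP em {T₀} edep T r _ =
    let g , anti , pos , cycles =
          EDEP⇒realisable em circle T₀ T edep (λ c → e^i (r c) , e^i∈𝕋 (r c))
    in gainGraph g anti , gainGraph∈𝒜 T anti r cycles , adjacency-nonneg anti pos

theorem4p4 : ExcludedMiddle (suc 0ℓ) → (ℛ : RealNumbers) → 𝔉′ ⊆ 𝒫 ℛ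
theorem4p4 em ℛ (connected , _ , edep) = connected , EDEP⇒GNRP ℛ em edep
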